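{- For every triangle-free graph $H$ on $h$ vertices there exists a constant $\alpha_H>0$ such that the following holds for all $0<\gamma\leq \frac12$ and all positive integers $n$. If $G$ is an $n$-vertex graph containing at least $\gamma n^h$ copies of $H$, then $G$ contains $H[k]$ as a subgraph for some positive integer $k$ with \[ k\geq \alpha_H\,\frac{\log n}{\log(1/\gamma)}. \]
   Context: For a graph $H$ and a positive integer $k$, the blowup $H[k]$ is the graph obtained from $H$ by replacing every vertex by an independent set of size $k$ and every edge by a complete bipartite graph $K_{k,k}$ between the corresponding independent sets. A copy of $H$ in $G$ is a subgraph of $G$ isomorphic to $H$. All logarithms are to base $2$. -}

module Defs where

open import Data.Fin using (Fin)
open import Data.Fin.Subset using (Subset; _∈_)
open import Data.Fin.Subset.Properties using (_∈?_)
open import Data.Integer as ℤ using (+_)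
import Data.Integer.Properties as ℤ
open import Data.List using (List; length)
open import Data.List.Relation.Unary.All using (All)
open import Data.List.Relation.Unary.Unique.Propositional using (Unique)
open import Data.Nat as ℕ using (ℕ; zero; suc)
open import Data.Nat.Coprimality as Coprime using (1-coprimeTo)
import Data.Nat.Properties as ℕ
open import Data.Product using (∃-syntax; Σ-syntax; _×_; _,_; proj₁)
open import Data.Rational as ℚ using (ℚ; 0ℚ; 1ℚ; ½)
import Data.Rational.Properties as ℚ
import Data.Rational.Unnormalised as ℚᵘ
import Data.Rational.Unnormalised.Properties as ℚᵘ
open import Data.Sum using (_⊎_; inj₁; inj₂)
open import Data.Vec using (Vec; lookup)
open import Function using (_↔_; _⇔_; Inverse)
open import Level using (0ℓ)
open import Relation.Binary using (Rel; Symmetric; Decidable)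
open import Relation.Binary.PropositionalEquality using (_≡_; refl; sym; trans; cong; subst₂)
open import Relation.Nullary using (¬_)
open import Relation.Nullary.Decidable using (from-yes)

open import Algebra.Definitions.RawSemiring ℚ.+-*-rawSemiring using () renaming (_^_ to _^ℚ_)

-- Non-negative reals as Dedekind cuts, each given by its lower half: a proper, downward closed
-- set of rationals without a greatest element. Being non-negative means
-- containing every negative rational. The cut of x is { q ∣ q < x }.

record ℝ≥0 : Set₁ where
  field
    Lower    : ℚ → Set
    negative : ∀ {q} → q ℚ.< 0ℚ → Lower q
    downward : ∀ {p q} → p ℚ.< q → Lower q → Lower p
    open′    : ∀ {p} → Lower p → ∃[ q ] p ℚ.< q × Lower q
    bounded  : ∃[ b ] (∀ {q} → Lower q → q ℚ.≤ b)

open ℝ≥0 public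

infix 4 _≤_ _<_

_≤_ : ℝ≥0 → ℝ≥0 → Set
x ≤ y = ∀ {q} → Lower x q → Lower y q

_<_ : ℝ≥0 → ℝ≥0 → Set
x < y = ∃[ q ] ¬ Lower x q × Lower y q

-- The supremum of P ∪ {0}. In every use below, P has a supremum that is
-- already non-negative, or P is empty and the intended value is 0.
sup : (P : ℚ → Set) → ∃[ b ] (∀ {p} → P p → p ℚ.≤ b) → ℝ≥0
sup P (b , P≤b) = record
  { Lower    = λ q → q ℚ.< 0ℚ ⊎ ∃[ p ] P p × q ℚ.< p
  ; negative = inj₁
  ; downward = λ where
      p<q (inj₁ q<0)              → inj₁ (ℚ.<-trans p<q q<0)
      p<q (inj₂ (r , r∈P , q<r)) → inj₂ (r , r∈P , ℚ.<-trans p<q q<r)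
  ; open′    = λ where
      (inj₁ q<0)             → let m , q<m , m<0 = ℚ.<-dense q<0 in m , q<m , inj₁ m<0
      (inj₂ (p , p∈P , q<p)) → let m , q<m , m<p = ℚ.<-dense q<p in m , q<m , inj₂ (p , p∈P , m<p)
  ; bounded  = b ℚ.⊔ 0ℚ , λ where
      (inj₁ q<0)             → ℚ.≤-trans (ℚ.<⇒≤ q<0) (ℚ.p≤q⊔p b 0ℚ)
      (inj₂ (p , p∈P , q<p)) → ℚ.≤-trans (ℚ.<⇒≤ q<p) (ℚ.≤-trans (P≤b p∈P) (ℚ.p≤p⊔q b 0ℚ))
  }

fromℚ : (r : ℚ) .{{_ : ℚ.NonNegative r}} → ℝ≥0
fromℚ r = record
  { Lower    = λ q → q ℚ.< r
  ; negative = λ q<0 → ℚ.<-≤-trans q<0 (ℚ.nonNegative⁻¹ r)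
  ; downward = ℚ.<-trans
  ; open′    = ℚ.<-dense
  ; bounded  = r , ℚ.<⇒≤
  }

ℕ⇒ℚ : ℕ → ℚ
ℕ⇒ℚ n = + n ℚ./ 1

fromℕ : ℕ → ℝ≥0
fromℕ n = fromℚ (ℕ⇒ℚ n) {{ℚ.normalize-nonNeg n 1}}

0ℝ 1ℝ ½ℝ : ℝ≥0
0ℝ = fromℕ 0
1ℝ = fromℕ 1
½ℝ = fromℚ ½

infixl 7 _*_

_*_ : ℝ≥0 → ℝ≥0 → ℝ≥0
x * y = sup
  (λ p → ∃[ a ] ∃[ b ] Lower x a × Lower y b × 0ℚ ℚ.≤ a × 0ℚ ℚ.≤ b × p ≡ a ℚ.* b)
  (proj₁ (bounded x) ℚ.* proj₁ (bounded y) , bound)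
  where
  bound : ∀ {p} → ∃[ a ] ∃[ b ] Lower x a × Lower y b × 0ℚ ℚ.≤ a × 0ℚ ℚ.≤ b × p ≡ a ℚ.* b →
          p ℚ.≤ proj₁ (bounded x) ℚ.* proj₁ (bounded y)
  bound (a , b , a∈x , b∈y , 0≤a , 0≤b , refl) with bounded x | bounded y
  ... | A , x≤A | B , y≤B = ℚ.≤-trans
    (ℚ.*-monoʳ-≤-nonNeg b {{ℚ.nonNegative 0≤b}} (x≤A a∈x))
    (ℚ.*-monoˡ-≤-nonNeg A {{ℚ.nonNegative (ℚ.≤-trans 0≤a (x≤A a∈x))}} (y≤B b∈y))

positive-member : ∀ {x} → 0ℝ < x → ∃[ s ] 0ℚ ℚ.< s × Lower x s
positive-member {x} (q , q≮0 , q∈x) with open′ x q∈x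
... | s , q<s , s∈x = s , ℚ.≤-<-trans (ℚ.≮⇒≥ q≮0) q<s , s∈x

-- 1/x is the supremum of the rationals r with x r ≤ 1.
recip : (x : ℝ≥0) → 0ℝ < x → ℝ≥0
recip x 0<x = sup (λ r → ∀ {s} → Lower x s → 0ℚ ℚ.< s → s ℚ.* r ℚ.≤ 1ℚ) (bound (positive-member {x} 0<x))
  where
  bound : ∃[ s ] 0ℚ ℚ.< s × Lower x s →
          ∃[ b ] (∀ {r} → (∀ {s} → Lower x s → 0ℚ ℚ.< s → s ℚ.* r ℚ.≤ 1ℚ) → r ℚ.≤ b)
  bound (s , 0<s , s∈x) = ℚ.1/ s , λ xr≤1 → ℚ.*-cancelˡ-≤-pos s
    (ℚ.≤-trans (xr≤1 s∈x 0<s) (ℚ.≤-reflexive (sym (ℚ.*-inverseʳ s))))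
    where instance
      s>0 : ℚ.Positive s
      s>0 = ℚ.positive 0<s
      s≢0 : ℚ.NonZero s
      s≢0 = ℚ.pos⇒nonZero s

divide : (x y : ℝ≥0) → 0ℝ < y → ℝ≥0
divide x y 0<y = x * recip y 0<y

0≤^ : ∀ r → 0ℚ ℚ.≤ r → ∀ n → 0ℚ ℚ.≤ r ^ℚ n
0≤^ r 0≤r zero    = ℚ.nonNegative⁻¹ 1ℚ
0≤^ r 0≤r (suc n) = ℚ.nonNegative⁻¹ _
  {{ℚ.nonNeg*nonNeg⇒nonNeg r {{ℚ.nonNegative 0≤r}} (r ^ℚ n) {{ℚ.nonNegative (0≤^ r 0≤r n)}}}}

^-monoˡ : ∀ {r s} → 0ℚ ℚ.≤ r → r ℚ.≤ s → ∀ n → r ^ℚ n ℚ.≤ s ^ℚ n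
^-monoˡ         0≤r r≤s zero    = ℚ.≤-refl
^-monoˡ {r} {s} 0≤r r≤s (suc n) = ℚ.≤-trans
  (ℚ.*-monoʳ-≤-nonNeg (r ^ℚ n) {{ℚ.nonNegative (0≤^ r 0≤r n)}} r≤s)
  (ℚ.*-monoˡ-≤-nonNeg s {{ℚ.nonNegative (ℚ.≤-trans 0≤r r≤s)}} (^-monoˡ 0≤r r≤s n))

ℕ⇒ℚ≡mkℚ : ∀ n → ℕ⇒ℚ n ≡ ℚ.mkℚ (+ n) 0 (Coprime.sym (1-coprimeTo n))
ℕ⇒ℚ≡mkℚ n = ℚ.normalize-coprime (Coprime.sym (1-coprimeTo n))

/-mono-≤ : ∀ m d n e → m ℕ.* suc e ℕ.≤ n ℕ.* suc d → + m ℚ./ suc d ℚ.≤ + n ℚ./ suc e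
/-mono-≤ m d n e le = ℚ.toℚᵘ-cancel-≤
  (ℚᵘ.≤-respˡ-≃ (ℚᵘ.≃-sym (ℚ.toℚᵘ-fromℚᵘ (ℚᵘ.mkℚᵘ (+ m) d)))
  (ℚᵘ.≤-respʳ-≃ (ℚᵘ.≃-sym (ℚ.toℚᵘ-fromℚᵘ (ℚᵘ.mkℚᵘ (+ n) e)))
  (ℚᵘ.*≤* (subst₂ ℤ._≤_ (ℤ.pos-* m (suc e)) (ℤ.pos-* n (suc d)) (ℤ.+≤+ le)))))

ℕ⇒ℚ-mono-≤ : ∀ {m n} → m ℕ.≤ n → ℕ⇒ℚ m ℚ.≤ ℕ⇒ℚ n
ℕ⇒ℚ-mono-≤ {m} {n} m≤n = /-mono-≤ m 0 n 0 (ℕ.*-monoˡ-≤ 1 m≤n)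

ℕ⇒ℚ-cancel-≤ : ∀ {m n} → ℕ⇒ℚ m ℚ.≤ ℕ⇒ℚ n → m ℕ.≤ n
ℕ⇒ℚ-cancel-≤ {m} {n} le rewrite ℕ⇒ℚ≡mkℚ m | ℕ⇒ℚ≡mkℚ n =
  ℤ.drop‿+≤+ (subst₂ ℤ._≤_ (ℤ.*-identityʳ (+ m)) (ℤ.*-identityʳ (+ n)) (ℚ.drop-*≤* le))

ℕ⇒ℚ-* : ∀ m n → ℕ⇒ℚ (m ℕ.* n) ≡ ℕ⇒ℚ m ℚ.* ℕ⇒ℚ n
ℕ⇒ℚ-* m n rewrite ℕ⇒ℚ≡mkℚ m | ℕ⇒ℚ≡mkℚ n | sym (ℤ.pos-* m n) = refl

ℕ⇒ℚ-^ : ∀ m n → ℕ⇒ℚ (m ℕ.^ n) ≡ ℕ⇒ℚ m ^ℚ n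
ℕ⇒ℚ-^ m zero    = refl
ℕ⇒ℚ-^ m (suc n) = trans (ℕ⇒ℚ-* m (m ℕ.^ n)) (cong (ℕ⇒ℚ m ℚ.*_) (ℕ⇒ℚ-^ m n))

n≤2^n : ∀ n → n ℕ.≤ 2 ℕ.^ n
n≤2^n zero    = ℕ.z≤n
n≤2^n (suc n) = ℕ.+-mono-≤ (ℕ.m^n>0 2 n) (ℕ.≤-trans (n≤2^n n) (ℕ.≤-reflexive (sym (ℕ.+-identityʳ _))))

archimedean : ∀ b → ∃[ n ] b ℚ.≤ ℕ⇒ℚ n
archimedean b@(ℚ.mkℚ (+ n) d _) = n , ℚ.≤-trans
  (ℚ.≤-reflexive (sym (ℚ.↥p/↧p≡p b)))
  (/-mono-≤ n d n 0 (ℕ.*-monoʳ-≤ n (ℕ.s≤s ℕ.z≤n)))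
archimedean (ℚ.mkℚ (ℤ.-[1+ n ]) d _) = 0 , ℚ.*≤* ℤ.-≤+

Log : ℝ≥0 → ℚ → Set
Log x p = ∃[ m ] ∃[ d ] ∃[ r ]
  Lower x r × 0ℚ ℚ.≤ r × ℕ⇒ℚ (2 ℕ.^ m) ℚ.≤ r ^ℚ suc d × p ≡ + m ℚ./ suc d

Log-bounded : ∀ x → ∃[ b ] (∀ {p} → Log x p → p ℚ.≤ b)
Log-bounded x with bounded x
... | b , x≤b with archimedean b
... | B , b≤B = ℕ⇒ℚ B , λ where
  (m , d , r , r∈x , 0≤r , 2^m≤r^d , refl) →
    let
      r≤2^B : r ℚ.≤ ℕ⇒ℚ (2 ℕ.^ B)
      r≤2^B = ℚ.≤-trans (x≤b r∈x) (ℚ.≤-trans b≤B (ℕ⇒ℚ-mono-≤ (n≤2^n B)))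
      2^m≤2^Bd : 2 ℕ.^ m ℕ.≤ 2 ℕ.^ (B ℕ.* suc d)
      2^m≤2^Bd = ℕ.≤-trans
        (ℕ⇒ℚ-cancel-≤ (ℚ.≤-trans 2^m≤r^d (ℚ.≤-trans (^-monoˡ 0≤r r≤2^B (suc d))
          (ℚ.≤-reflexive (sym (ℕ⇒ℚ-^ (2 ℕ.^ B) (suc d)))))))
        (ℕ.≤-reflexive (ℕ.^-*-assoc 2 B (suc d)))
      m≤Bd : m ℕ.≤ B ℕ.* suc d
      m≤Bd = ℕ.≮⇒≥ λ Bd<m → ℕ.<⇒≱ (ℕ.^-monoʳ-< 2 (ℕ.s≤s (ℕ.s≤s ℕ.z≤n)) Bd<m) 2^m≤2^Bd
    in /-mono-≤ m d B 0 (ℕ.≤-trans (ℕ.≤-reflexive (ℕ.*-identityʳ m)) m≤Bd)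

-- log₂ x is the supremum of the fractions m / (d + 1) with 2 ^ (m / (d + 1)) ≤ r
-- for some rational r < x; the restriction to x ≥ 1 makes it non-negative.
log₂ : (x : ℝ≥0) → .(1ℝ ≤ x) → ℝ≥0
log₂ x _ = sup (Log x) (Log-bounded x)

1≤fromℕ : ∀ n .{{_ : ℕ.NonZero n}} → 1ℝ ≤ fromℕ n
1≤fromℕ n q<1 = ℚ.<-≤-trans q<1 (ℕ⇒ℚ-mono-≤ (ℕ.>-nonZero⁻¹ n))

module _ (γ : ℝ≥0) (0<γ : 0ℝ < γ) (γ≤½ : γ ≤ ½ℝ) where

  γ*2≤1 : ∀ {s} → Lower γ s → s ℚ.* ℕ⇒ℚ 2 ℚ.≤ 1ℚ
  γ*2≤1 s∈γ = ℚ.*-monoʳ-≤-nonNeg (ℕ⇒ℚ 2) (ℚ.<⇒≤ (γ≤½ s∈γ))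

  Lower-recip : ∀ {q} → q ℚ.< ℕ⇒ℚ 2 → Lower (recip γ 0<γ) q
  Lower-recip q<2 = inj₂ (ℕ⇒ℚ 2 , (λ s∈γ _ → γ*2≤1 s∈γ) , q<2)

  1≤recip : 1ℝ ≤ recip γ 0<γ
  1≤recip q<1 = Lower-recip (ℚ.<-trans q<1 (from-yes (ℕ⇒ℚ 1 ℚ.<? ℕ⇒ℚ 2)))

  0<log₂-recip : 0ℝ < log₂ (recip γ 0<γ) 1≤recip
  0<log₂-recip = 0ℚ , ℚ.<-irrefl refl , inj₂
    ( ½
    , (1 , 1 , + 3 ℚ./ 2 , Lower-recip (from-yes (+ 3 ℚ./ 2 ℚ.<? ℕ⇒ℚ 2))
      , from-yes (0ℚ ℚ.≤? + 3 ℚ./ 2) , from-yes (ℕ⇒ℚ 2 ℚ.≤? (+ 3 ℚ./ 2) ^ℚ 2) , refl)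
    , from-yes (0ℚ ℚ.<? ½))

record Graph (V : Set) : Set₁ where
  infix 4 _~_ _~?_
  field
    _~_    : Rel V 0ℓ
    _~?_   : Decidable _~_
    ~-sym  : Symmetric _~_
    ~-irr  : ∀ {v} → ¬ v ~ v

TriangleFree : ∀ {V} → Graph V → Set
TriangleFree G = ∀ u v w → ¬ (u ~ v × v ~ w × w ~ u)
  where open Graph G

_[_] : ∀ {V} → Graph V → (k : ℕ) → Graph (V × Fin k)
H [ k ] = record
  { _~_   = λ (u , _) (v , _) → u ~ v
  ; _~?_  = λ (u , _) (v , _) → u ~? v
  ; ~-sym = ~-sym
  ; ~-irr = ~-irr
  }
  where open Graph H

infix 4 _≅_

record _≅_ {V W : Set} (G : Graph V) (H : Graph W) : Set where
  private
    module G = Graph G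
    module H = Graph H
  field
    bijection : V ↔ W
    adjacency : ∀ u v → (u G.~ v) ⇔ (Inverse.to bijection u H.~ Inverse.to bijection v)

-- Vertex set and edge set (as the rows of an adjacency matrix) of a potential
-- subgraph. These are tables of booleans, so that propositional equality
-- identifies exactly the subgraphs with the same vertices and the same edges.
record Subgraph (n : ℕ) : Set where
  field
    vertices  : Subset n
    adjacents : Vec (Subset n) n

  Edge : Rel (Fin n) 0ℓ
  Edge u v = v ∈ lookup adjacents u

open Subgraph public using (vertices; Edge)

infix 4 _⊑_

record _⊑_ {n} (S : Subgraph n) (G : Graph (Fin n)) : Set where
  open Graph G
  field
    edge-sym      : ∀ {u v} → Edge S u v → Edge S v u
    edge⇒vertex   : ∀ {u v} → Edge S u v → u ∈ vertices S
    edge⇒adjacent : ∀ {u v} → Edge S u v → u ~ v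

toGraph : ∀ {n} {S : Subgraph n} {G : Graph (Fin n)} → S ⊑ G → Graph (∃[ v ] v ∈ vertices S)
toGraph {S = S} {G} S⊑G = record
  { _~_   = λ (u , _) (v , _) → Edge S u v
  ; _~?_  = λ (u , _) (v , _) → v ∈? lookup (Subgraph.adjacents S) u
  ; ~-sym = edge-sym
  ; ~-irr = λ e → Graph.~-irr G (edge⇒adjacent e)
  }
  where open _⊑_ S⊑G

IsCopy : ∀ {V n} → Graph V → Graph (Fin n) → Subgraph n → Set
IsCopy H G S = Σ[ S⊑G ∈ S ⊑ G ] H ≅ toGraph S⊑G

infix 4 _ContainsAsSubgraph_

_ContainsAsSubgraph_ : ∀ {V n} → Graph (Fin n) → Graph V → Set
G ContainsAsSubgraph H = ∃[ S ] IsCopy H G S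

-- At least x subgraphs of G are copies of H: some list of distinct copies has
-- length at least x.
AtLeastCopies : ∀ {V n} → ℝ≥0 → Graph V → Graph (Fin n) → Set
AtLeastCopies {n = n} x H G =
  Σ[ copies ∈ List (Subgraph n) ] Unique copies × All (IsCopy H G) copies × x ≤ fromℕ (length copies)

module Submission where

-- Remove the vertices of H one at a time, replacing each by k vertices of G. When v is removed, the
-- neighbourhood I of v is independent, so a tuple u of candidates for I extends to a copy of H in w(u) ways
-- z = (image of v, images of the vertices outside I), and nothing is required among the entries of u.
-- Choose z₁, …, z_k greedily and keep only the candidates for I compatible with all of them: a tuple
-- then survives with weight w(u)ᵏ. As w is at least a constant times the copy density γ on a γ-fraction of
-- tuples, the tuples with many extensions dominate those with w far below γ after k steps. Hence the
-- surviving candidate sets, smaller by a factor γ^O(k), contain copies of H − v with density γ^O(1), and the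
-- k images of v are joined to all survivors in I. This can be repeated for every vertex of H if n ≥ γ^-O(k).

open import Defs using (Graph; TriangleFree; Subgraph; _⊑_; IsCopy; _≅_; _ContainsAsSubgraph_; _[_]; vertices; Edge; n≤2^n)

-- The survivors of `k` greedy choices must be numerous and dense at once, and as `k` is unbounded,
-- the density may not lose even a constant factor per choice. Both demands are encoded in one
-- inequality: the scaled weight of the good tuples exceeds that of the bad ones by a fixed surplus.
-- Normalised by `M`, the factor `D * w u z` averages over `z` to at least 1 on good tuples and at
-- most 1 on bad ones, so some `z` preserves the inequality. In the end all survivors carry the same
-- factor `D ^ k`: the comparison with the bad tuples gives a density independent of `k`, and the
-- surplus gives the size.
--
-- Distinctness of the chosen vertices is not encoded in the tuples that are counted, which are mere
-- homomorphisms. Used vertices are skipped instead, and a factor 2 between the thresholds for good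
-- and bad pays for this. Densities are bounded by negative powers of 2, which keeps the
-- combinatorics in ℕ. The starting exponent is read off from the number of copies, since a cut such
-- as `γ` cannot be compared with rationals by a decision procedure.

module Combinatorics where

  open import Data.Bool using (Bool; true; false; if_then_else_)
  open import Data.Fin as Fin using (Fin; zero; suc)
  import Data.Fin.Properties as Fin
  open import Data.Fin.Subset as Subset using (Subset)
  open import Data.Fin.Subset.Properties using (⊆-antisym)
  open import Data.List using (List; []; _∷_; map; _++_; length; filter; cartesianProduct; cartesianProductWith; allFin)
  import Data.List.Properties as List
  open import Data.List.Membership.DecPropositional using () renaming (_∈?_ to member?)
  open import Data.List.Membership.Propositional using (_∈_; _∉_)
  open import Data.List.Membership.Propositional.Properties using (∈-filter⁺; ∈-filter⁻; ∈-cartesianProduct⁻; ∈-cartesianProductWith⁺; ∈-allFin; ∈-++⁺ˡ; ∈-++⁺ʳ)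
  open import Data.List.Relation.Unary.All as All using (All; []; _∷_)
  open import Data.List.Relation.Unary.AllPairs using ([]; _∷_)
  open import Data.List.Relation.Unary.Any as Any using (here; there)
  open import Data.List.Relation.Unary.Unique.Propositional using (Unique)
  import Data.List.Relation.Unary.Unique.Propositional.Properties as Unique
  open import Data.Nat using (ℕ; zero; suc; _+_; _*_; _^_; _≤_; _<_; _≤?_; z≤n; s≤s; >-nonZero)
  open import Data.Nat.ListAction using (sum)
  open import Data.Nat.Properties
  open import Data.Nat.Tactic.RingSolver using (solve-∀)
  open import Data.Product using (∃-syntax; _×_; _,_; proj₁; proj₂)
  open import Data.Vec as Vec using (Vec; []; _∷_; lookup; tabulate; toList)
  open import Data.Vec.Membership.Propositional.Properties using (∈-toList⁺; ∈-lookup)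
  open import Data.Vec.Properties using (lookup-map; lookup∘tabulate; tabulate∘lookup; tabulate-cong; lookup⇒[]=; []=⇒lookup; length-toList; ≡-dec)
  open import Data.Vec.Properties.WithK using ([]=-irrelevant)
  open import Data.Vec.Relation.Unary.All as VecAll using ([]; _∷_)
  open import Data.Vec.Relation.Unary.AllPairs using ([]; _∷_)
  import Data.Vec.Relation.Unary.All.Properties as VecAll
  import Data.Vec.Relation.Unary.Unique.Propositional as VecUnique
  import Data.Vec.Relation.Unary.Unique.Propositional.Properties as VecUnique
  open import Function using (_∘_; Inverse; Equivalence; mk↔ₛ′; mk⇔)
  open import Relation.Binary using (DecidableEquality)
  open import Relation.Binary.PropositionalEquality hiding ([_])
  open import Relation.Nullary using (Dec; does; yes; no; ¬_; contradiction; _×-dec_; _→-dec_; ¬?)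
  open import Relation.Nullary.Decidable using (dec-true; dec-false; decidable-stable)
  open import Relation.Unary using (Decidable)
  open import Algebra.Properties.CommutativeSemigroup +-commutativeSemigroup using (interchange)

  private variable
    A B C P Q : Set

  -- Finite sums and indicators

  ∑ : List A → (A → ℕ) → ℕ
  ∑ xs f = sum (map f xs)

  ∑-mono : ∀ (xs : List A) {f g} → (∀ x → f x ≤ g x) → ∑ xs f ≤ ∑ xs g
  ∑-mono []       f≤g = z≤n
  ∑-mono (x ∷ xs) f≤g = +-mono-≤ (f≤g x) (∑-mono xs f≤g)

  ∑-cong : ∀ (xs : List A) {f g} → (∀ x → f x ≡ g x) → ∑ xs f ≡ ∑ xs g
  ∑-cong []       f≗g = refl
  ∑-cong (x ∷ xs) f≗g = cong₂ _+_ (f≗g x) (∑-cong xs f≗g)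

  ∑-+ : ∀ (xs : List A) (f g : A → ℕ) → ∑ xs (λ x → f x + g x) ≡ ∑ xs f + ∑ xs g
  ∑-+ []       f g = refl
  ∑-+ (x ∷ xs) f g = trans (cong ((f x + g x) +_) (∑-+ xs f g)) (interchange (f x) (g x) _ _)

  ∑-*ˡ : ∀ (xs : List A) c (f : A → ℕ) → ∑ xs (λ x → c * f x) ≡ c * ∑ xs f
  ∑-*ˡ []       c f = sym (*-zeroʳ c)
  ∑-*ˡ (x ∷ xs) c f = trans (cong (c * f x +_) (∑-*ˡ xs c f)) (sym (*-distribˡ-+ c (f x) _))

  ∑-const : ∀ (xs : List A) c → ∑ xs (λ _ → c) ≡ length xs * c
  ∑-const []       c = refl
  ∑-const (x ∷ xs) c = cong (c +_) (∑-const xs c)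

  ∑-1 : ∀ (xs : List A) → ∑ xs (λ _ → 1) ≡ length xs
  ∑-1 xs = trans (∑-const xs 1) (*-identityʳ _)

  ∑-swap : ∀ (xs : List A) (ys : List B) (f : A → B → ℕ) → ∑ xs (λ x → ∑ ys (f x)) ≡ ∑ ys (λ y → ∑ xs (λ x → f x y))
  ∑-swap []       ys f = sym (trans (∑-const ys 0) (*-zeroʳ (length ys)))
  ∑-swap (x ∷ xs) ys f = trans (cong (∑ ys (f x) +_) (∑-swap xs ys f)) (sym (∑-+ ys (f x) _))

  ∑-++ : ∀ (xs ys : List A) (f : A → ℕ) → ∑ (xs ++ ys) f ≡ ∑ xs f + ∑ ys f
  ∑-++ []       ys f = refl
  ∑-++ (x ∷ xs) ys f = trans (cong (f x +_) (∑-++ xs ys f)) (sym (+-assoc (f x) _ _))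

  ∑-cartesianProductWith : ∀ (h : A → B → C) xs ys (f : C → ℕ) →
    ∑ (cartesianProductWith h xs ys) f ≡ ∑ xs (λ x → ∑ ys (λ y → f (h x y)))
  ∑-cartesianProductWith h []       ys f = refl
  ∑-cartesianProductWith h (x ∷ xs) ys f = trans (∑-++ (map (h x) ys) _ f)
    (cong₂ _+_ (cong sum (sym (List.map-∘ ys))) (∑-cartesianProductWith h xs ys f))

  -- Positivity excludes the empty list. It passes to the tail because a head that fails leaves a
  -- strict inequality between the remaining sums.
  ∑-≤-choice : ∀ (xs : List A) (f g : A → ℕ) → 0 < ∑ xs g → ∑ xs f ≤ ∑ xs g → ∃[ x ] x ∈ xs × f x ≤ g x
  ∑-≤-choice (x ∷ xs) f g 0<∑g ∑f≤∑g with f x ≤? g x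
  ... | yes fx≤gx = x , here refl , fx≤gx
  ... | no  fx≰gx =
    let ∑f<∑g = +-cancelˡ-< (g x) (∑ xs f) (∑ xs g)
                  (<-≤-trans (+-monoˡ-< (∑ xs f) (≰⇒> fx≰gx)) ∑f≤∑g)
        y , y∈xs , fy≤gy = ∑-≤-choice xs f g (≤-<-trans z≤n ∑f<∑g) (<⇒≤ ∑f<∑g)
    in y , there y∈xs , fy≤gy

  𝟙 : Dec P → ℕ
  𝟙 P? = if does P? then 1 else 0

  𝟙≤1 : (P? : Dec P) → 𝟙 P? ≤ 1
  𝟙≤1 (yes _) = ≤-refl
  𝟙≤1 (no  _) = z≤n

  𝟙-yes : (P? : Dec P) → P → 𝟙 P? ≡ 1
  𝟙-yes (yes _)  p = refl
  𝟙-yes (no  ¬p) p = contradiction p ¬p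

  𝟙-mono : (P? : Dec P) (Q? : Dec Q) → (P → Q) → 𝟙 P? ≤ 𝟙 Q?
  𝟙-mono (no  _) Q?       P⇒Q = z≤n
  𝟙-mono (yes p) Q?       P⇒Q = ≤-reflexive (sym (𝟙-yes Q? (P⇒Q p)))

  𝟙-cong : (P? : Dec P) (Q? : Dec Q) → (P → Q) → (Q → P) → 𝟙 P? ≡ 𝟙 Q?
  𝟙-cong P? Q? P⇒Q Q⇒P = ≤-antisym (𝟙-mono P? Q? P⇒Q) (𝟙-mono Q? P? Q⇒P)

  𝟙-× : (P? : Dec P) (Q? : Dec Q) → 𝟙 (P? ×-dec Q?) ≡ 𝟙 P? * 𝟙 Q?
  𝟙-× (yes _) (yes _) = refl
  𝟙-× (yes _) (no  _) = refl
  𝟙-× (no  _) Q?      = refl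

  𝟙-¬ : (P? : Dec P) → 𝟙 P? + 𝟙 (¬? P?) ≡ 1
  𝟙-¬ (yes _) = refl
  𝟙-¬ (no  _) = refl

  𝟙-positive : (P? : Dec P) → 0 < 𝟙 P? → P
  𝟙-positive (yes p) _ = p

  ∑-filter : ∀ {P : A → Set} (P? : Decidable P) xs (f : A → ℕ) → ∑ (filter P? xs) f ≡ ∑ xs (λ x → 𝟙 (P? x) * f x)
  ∑-filter P? []       f = refl
  ∑-filter P? (x ∷ xs) f with P? x
  ... | yes _ = cong₂ _+_ (sym (+-identityʳ (f x))) (∑-filter P? xs f)
  ... | no  _ = ∑-filter P? xs f

  length-Unique-⊆ : DecidableEquality A → ∀ {xs ys : List A} → Unique xs → (∀ {x} → x ∈ xs → x ∈ ys) → length xs ≤ length ys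
  length-Unique-⊆ _≟_ []                        xs⊆ys = z≤n
  length-Unique-⊆ _≟_ {x ∷ _} {ys} (x≢xs ∷ xs!) xs⊆ys = ≤-<-trans
    (length-Unique-⊆ _≟_ xs! λ y∈xs → ∈-filter⁺ ≢x? (xs⊆ys (there y∈xs)) (All.lookup x≢xs y∈xs))
    (List.filter-notAll ≢x? ys (Any.map (λ x≡y x≢y → x≢y x≡y) (xs⊆ys (here refl))))
    where
    ≢x? = λ y → ¬? (x ≟ y)

  ∑-filter-≤ : ∀ {P : A → Set} (P? : ∀ x → Dec (P x)) xs (f : A → ℕ) → ∑ (filter P? xs) f ≤ ∑ xs f
  ∑-filter-≤ P? xs f = ≤-trans (≤-reflexive (∑-filter P? xs f))
    (∑-mono xs λ x → ≤-trans (*-monoˡ-≤ (f x) (𝟙≤1 (P? x))) (≤-reflexive (*-identityˡ (f x))))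

  -- Boxes of tuples

  box : ∀ {r} → (Fin r → List A) → List (Vec A r)
  box {r = zero}  V = [] ∷ []
  box {r = suc r} V = cartesianProductWith _∷_ (V zero) (box (V ∘ suc))

  ∑-box : ∀ {r} (V : Fin (suc r) → List A) (f : Vec A (suc r) → ℕ) →
    ∑ (box V) f ≡ ∑ (V zero) (λ x → ∑ (box (V ∘ suc)) (λ u → f (x ∷ u)))
  ∑-box V f = ∑-cartesianProductWith _∷_ (V zero) (box (V ∘ suc)) f

  length-box : ∀ {r} (V : Fin (suc r) → List A) → length (box V) ≡ length (V zero) * length (box (V ∘ suc))
  length-box V = begin
    length (box V)                                    ≡⟨ ∑-1 (box V) ⟨
    ∑ (box V) (λ _ → 1)                               ≡⟨ ∑-box V _ ⟩
    ∑ (V zero) (λ _ → ∑ (box (V ∘ suc)) (λ _ → 1))    ≡⟨ ∑-const (V zero) _ ⟩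
    length (V zero) * ∑ (box (V ∘ suc)) (λ _ → 1)     ≡⟨ cong (length (V zero) *_) (∑-1 (box (V ∘ suc))) ⟩
    length (V zero) * length (box (V ∘ suc))          ∎
    where open ≡-Reasoning

  mix : ∀ {r} → (Fin r → Bool) → Vec A r → Vec A r → Vec A r
  mix m []      []      = []
  mix m (x ∷ u) (y ∷ v) = (if m zero then x else y) ∷ mix (m ∘ suc) u v

  lookup-mix : ∀ {r} (m : Fin r → Bool) (u v : Vec A r) i →
    lookup (mix m u v) i ≡ (if m i then lookup u i else lookup v i)
  lookup-mix m (x ∷ u) (y ∷ v) zero    = refl
  lookup-mix m (x ∷ u) (y ∷ v) (suc i) = lookup-mix (m ∘ suc) u v i

  -- In each coordinate one of the two entries is used and the other is free. Where `m i` is true,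
  -- the free entry runs over `V i`; where it is false, it runs over `W i`, which equals `V i`. So
  -- the free entries contribute `length (box V)` in total.
  ∑-mix : ∀ {r} (m : Fin r → Bool) (V W : Fin r → List A) (f : Vec A r → ℕ) →
    (∀ i → m i ≡ false → W i ≡ V i) →
    ∑ (box W) (λ u → ∑ (box V) (λ v → f (mix m u v))) ≡ length (box V) * ∑ (box W) f
  ∑-mix {r = zero}  m V W f W≡V = solve-∀′ (f [])
    where
    solve-∀′ : ∀ a → a + 0 + 0 ≡ 1 * (a + 0)
    solve-∀′ = solve-∀
  ∑-mix {A = A} {r = suc r} m V W f W≡V = begin
    ∑ (box W) (λ u → ∑ (box V) (λ v → f (mix m u v)))
      ≡⟨ ∑-box W _ ⟩
    ∑ (W zero) (λ x → ∑ W′ (λ u → ∑ (box V) (λ v → f (mix m (x ∷ u) v))))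
      ≡⟨ ∑-cong (W zero) (λ x → ∑-cong W′ (λ u → ∑-box V _)) ⟩
    ∑ (W zero) (λ x → ∑ W′ (λ u → ∑ (V zero) (λ y → ∑ V′ (λ v → f (pick x y ∷ mix (m ∘ suc) u v)))))
      ≡⟨ ∑-cong (W zero) (λ x → ∑-swap W′ (V zero) _) ⟩
    ∑ (W zero) (λ x → ∑ (V zero) (λ y → ∑ W′ (λ u → ∑ V′ (λ v → f (pick x y ∷ mix (m ∘ suc) u v)))))
      ≡⟨ ∑-cong (W zero) (λ x → ∑-cong (V zero) (λ y → ∑-mix (m ∘ suc) (V ∘ suc) (W ∘ suc) _ (W≡V ∘ suc))) ⟩
    ∑ (W zero) (λ x → ∑ (V zero) (λ y → length V′ * ∑ W′ (λ u → f (pick x y ∷ u))))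
      ≡⟨ ∑-pick (m zero) (W≡V zero) (λ x → length V′ * ∑ W′ (λ u → f (x ∷ u))) ⟩
    length (V zero) * ∑ (W zero) (λ x → length V′ * ∑ W′ (λ u → f (x ∷ u)))
      ≡⟨ cong (length (V zero) *_) (∑-*ˡ (W zero) (length V′) _) ⟩
    length (V zero) * (length V′ * ∑ (W zero) (λ x → ∑ W′ (λ u → f (x ∷ u))))
      ≡⟨ *-assoc (length (V zero)) (length V′) _ ⟨
    length (V zero) * length V′ * ∑ (W zero) (λ x → ∑ W′ (λ u → f (x ∷ u)))
      ≡⟨ cong₂ _*_ (length-box V) (∑-box W f) ⟨
    length (box V) * ∑ (box W) f ∎
    where
    open ≡-Reasoning
    V′ = box (V ∘ suc)
    W′ = box (W ∘ suc)
    pick : A → A → A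
    pick x y = if m zero then x else y
    ∑-pick : ∀ b → (b ≡ false → W zero ≡ V zero) → ∀ g →
      ∑ (W zero) (λ x → ∑ (V zero) (λ y → g (if b then x else y))) ≡ length (V zero) * ∑ (W zero) g
    ∑-pick true  _   g = trans (∑-cong (W zero) (λ x → ∑-const (V zero) (g x))) (∑-*ˡ (W zero) (length (V zero)) g)
    ∑-pick false eq  g rewrite eq refl = ∑-const (V zero) _

  ∑-box-filter : ∀ {r} {Q : Fin r → A → Set} (Q? : ∀ i x → Dec (Q i x))
    (all? : ∀ u → Dec (∀ i → Q i (lookup u i))) (V : Fin r → List A) (f : Vec A r → ℕ) →
    ∑ (box (λ i → filter (Q? i) (V i))) f ≡ ∑ (box V) (λ u → 𝟙 (all? u) * f u)
  ∑-box-filter {r = zero}  Q? all? V f = cong (_+ 0) (sym (trans (cong (_* f []) (𝟙-yes (all? []) λ ())) (*-identityˡ (f []))))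
  ∑-box-filter {A = A} {r = suc r} {Q} Q? all? V f = begin
    ∑ (box W) f
      ≡⟨ ∑-box W f ⟩
    ∑ (W zero) (λ x → ∑ (box (W ∘ suc)) (λ u → f (x ∷ u)))
      ≡⟨ ∑-filter (Q? zero) (V zero) _ ⟩
    ∑ (V zero) (λ x → 𝟙 (Q? zero x) * ∑ (box (W ∘ suc)) (λ u → f (x ∷ u)))
      ≡⟨ ∑-cong (V zero) (λ x → cong (𝟙 (Q? zero x) *_) (∑-box-filter (Q? ∘ suc) all?′ (V ∘ suc) (λ u → f (x ∷ u)))) ⟩
    ∑ (V zero) (λ x → 𝟙 (Q? zero x) * ∑ (box (V ∘ suc)) (λ u → 𝟙 (all?′ u) * f (x ∷ u)))
      ≡⟨ ∑-cong (V zero) (λ x → ∑-*ˡ (box (V ∘ suc)) (𝟙 (Q? zero x)) _) ⟨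
    ∑ (V zero) (λ x → ∑ (box (V ∘ suc)) (λ u → 𝟙 (Q? zero x) * (𝟙 (all?′ u) * f (x ∷ u))))
      ≡⟨ ∑-cong (V zero) (λ x → ∑-cong (box (V ∘ suc)) (λ u → *-assoc (𝟙 (Q? zero x)) _ _)) ⟨
    ∑ (V zero) (λ x → ∑ (box (V ∘ suc)) (λ u → 𝟙 (Q? zero x) * 𝟙 (all?′ u) * f (x ∷ u)))
      ≡⟨ ∑-cong (V zero) (λ x → ∑-cong (box (V ∘ suc)) (λ u → cong (_* f (x ∷ u)) (𝟙-all x u))) ⟩
    ∑ (V zero) (λ x → ∑ (box (V ∘ suc)) (λ u → 𝟙 (all? (x ∷ u)) * f (x ∷ u)))
      ≡⟨ ∑-box V _ ⟨
    ∑ (box V) (λ u → 𝟙 (all? u) * f u) ∎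
    where
    open ≡-Reasoning
    W = λ i → filter (Q? i) (V i)
    all?′ : ∀ (u : Vec A r) → Dec (∀ i → Q (suc i) (lookup u i))
    all?′ u = Fin.all? (λ i → Q? (suc i) (lookup u i))
    𝟙-all : ∀ x u → 𝟙 (Q? zero x) * 𝟙 (all?′ u) ≡ 𝟙 (all? (x ∷ u))
    𝟙-all x u = trans (sym (𝟙-× (Q? zero x) (all?′ u))) (𝟙-cong (Q? zero x ×-dec all?′ u) (all? (x ∷ u))
      (λ { (q , qs) zero → q ; (q , qs) (suc i) → qs i }) (λ qs → qs zero , qs ∘ suc))

  -- Greedy selection by reweighting

  -- The product of `g u` with `D * w u z` over all entries `z` of the vector. It is accumulated in
  -- `g`, so that every choice is an instance of the same averaging step.
  reweight : ∀ {k} → ℕ → (A → B → ℕ) → (A → ℕ) → Vec B k → A → ℕ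
  reweight D w g []       u = g u
  reweight D w g (z ∷ zs) u = reweight D w (λ u → g u * (D * w u z)) zs u

  fresh? : ∀ {n} (label : B → Fin n) Y z → Dec (label z ∉ Y)
  fresh? label Y z = ¬? (member? Fin._≟_ (label z) Y)

  module _ {n D M X : ℕ} (us : List A) (zs : List B) (w : A → B → ℕ) (0<X : 0 < X) (0<M : 0 < M) where

    -- Averaging over z: the mean of D * w u z is at least 1 on the support of g and at most 1 on that of b.
    reweighting-step : ∀ zs′ (b g : A → ℕ) → length zs′ ≤ M →
      (∀ u → 0 < g u → M ≤ D * ∑ zs′ (w u)) → (∀ u → 0 < b u → D * ∑ zs′ (w u) ≤ M) →
      ∑ us b + X ≤ ∑ us g →
      ∃[ z ] z ∈ zs′ × ∑ us (λ u → b u * (D * w u z)) + X ≤ ∑ us (λ u → g u * (D * w u z))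
    reweighting-step zs′ b g |zs′|≤M g-heavy b-light b+X≤g =
      ∑-≤-choice zs′ _ _ (<-≤-trans 0<bX bX≤g′) (≤-trans b′X≤bX bX≤g′)
      where
      open ≤-Reasoning
      0<bX : 0 < (∑ us b + X) * M
      0<bX = *-mono-≤ {1} {_} {1} (≤-trans 0<X (m≤n+m X (∑ us b))) 0<M
      ∑-reweight : ∀ f → ∑ zs′ (λ z → ∑ us (λ u → f u * (D * w u z))) ≡ ∑ us (λ u → f u * (D * ∑ zs′ (w u)))
      ∑-reweight f = trans (∑-swap zs′ us _) (∑-cong us λ u →
        trans (∑-*ˡ zs′ (f u) _) (cong (f u *_) (∑-*ˡ zs′ D (w u))))
      *-mono-support : ∀ a {x y} → (0 < a → x ≤ y) → a * x ≤ a * y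
      *-mono-support zero    _   = z≤n
      *-mono-support (suc a) x≤y = *-monoʳ-≤ (suc a) (x≤y (s≤s z≤n))
      ∑-*M : ∀ f → ∑ us (λ u → f u * M) ≡ ∑ us f * M
      ∑-*M f = trans (∑-cong us (λ u → *-comm (f u) M)) (trans (∑-*ˡ us M f) (*-comm M _))
      bX≤g′ : (∑ us b + X) * M ≤ ∑ zs′ (λ z → ∑ us (λ u → g u * (D * w u z)))
      bX≤g′ = begin
        (∑ us b + X) * M                                  ≤⟨ *-monoˡ-≤ M b+X≤g ⟩
        ∑ us g * M                                        ≡⟨ ∑-*M g ⟨
        ∑ us (λ u → g u * M)                              ≤⟨ ∑-mono us (λ u → *-mono-support (g u) (g-heavy u)) ⟩
        ∑ us (λ u → g u * (D * ∑ zs′ (w u)))              ≡⟨ ∑-reweight g ⟨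
        ∑ zs′ (λ z → ∑ us (λ u → g u * (D * w u z)))      ∎
      b′X≤bX : ∑ zs′ (λ z → ∑ us (λ u → b u * (D * w u z)) + X) ≤ (∑ us b + X) * M
      b′X≤bX = begin
        ∑ zs′ (λ z → ∑ us (λ u → b u * (D * w u z)) + X)  ≡⟨ ∑-+ zs′ _ _ ⟩
        ∑ zs′ (λ z → ∑ us (λ u → b u * (D * w u z))) + ∑ zs′ (λ _ → X)
          ≡⟨ cong₂ _+_ (∑-reweight b) (∑-const zs′ X) ⟩
        ∑ us (λ u → b u * (D * ∑ zs′ (w u))) + length zs′ * X
          ≤⟨ +-mono-≤ (∑-mono us (λ u → *-mono-support (b u) (b-light u))) (*-monoˡ-≤ X |zs′|≤M) ⟩
        ∑ us (λ u → b u * M) + M * X                      ≡⟨ cong₂ _+_ (∑-*M b) (*-comm M X) ⟩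
        ∑ us b * M + X * M                                ≡⟨ *-distribʳ-+ M (∑ us b) X ⟨
        (∑ us b + X) * M                                  ∎

    module _ {L : ℕ} (label : B → Fin n) where

      -- The conditions on `g` and `b` concern only their supports, which multiplication by
      -- `D * w u z` cannot enlarge, so they persist. Chosen labels accumulate in `Y`; `g-heavy`
      -- quantifies over all lists of at most `L` labels in order to apply to each stage. The
      -- surplus `X` passes through undiminished.
      reweighting : ∀ k Y (b g : A → ℕ) → length zs ≤ M → k + length Y ≤ L →
        (∀ u → 0 < g u → ∀ Y → length Y ≤ L → M ≤ D * ∑ (filter (fresh? label Y) zs) (w u)) →
        (∀ u → 0 < b u → D * ∑ zs (w u) ≤ M) →
        ∑ us b + X ≤ ∑ us g →
        ∃[ s ] VecAll.All (_∈ zs) {k} s × VecAll.All (_∉ Y) (Vec.map label s) × VecUnique.Unique (Vec.map label s) ×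
          ∑ us (reweight D w b s) + X ≤ ∑ us (reweight D w g s)
      reweighting zero    Y b g |zs|≤M |Y|≤L g-heavy b-light b+X≤g = [] , [] , [] , [] , b+X≤g
      reweighting (suc k) Y b g |zs|≤M |Y|≤L g-heavy b-light b+X≤g =
        let z , z∈zs′ , b′+X≤g′ = reweighting-step (filter (fresh? label Y) zs) b g
              (≤-trans (List.length-filter (fresh? label Y) zs) |zs|≤M)
              (λ u 0<gu → g-heavy u 0<gu Y (≤-trans (m≤n+m _ (suc k)) |Y|≤L))
              (λ u 0<bu → ≤-trans (*-monoʳ-≤ D (∑-filter-≤ (fresh? label Y) zs (w u))) (b-light u 0<bu))
              b+X≤g
            z∈zs , z∉Y = ∈-filter⁻ (fresh? label Y) {xs = zs} z∈zs′
            s , s∈zs , s∉zY , s! , le = reweighting k (label z ∷ Y) _ _ |zs|≤M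
              (≤-trans (≤-reflexive (+-suc k _)) |Y|≤L)
              (λ u 0<gu → g-heavy u (0<m*n⇒0<m (g u) 0<gu))
              (λ u 0<bu → b-light u (0<m*n⇒0<m (b u) 0<bu))
              b′+X≤g′
        in z ∷ s , z∈zs ∷ s∈zs , z∉Y ∷ VecAll.map (λ y∉zY → y∉zY ∘ there) s∉zY ,
           VecAll.map (λ y∉zY z≡y → y∉zY (here (sym z≡y))) s∉zY ∷ s! , le
        where
        0<m*n⇒0<m : ∀ m {n} → 0 < m * n → 0 < m
        0<m*n⇒0<m (suc m) _ = s≤s z≤n

  -- For an indicator weight the product vanishes unless `u` passes all tests, and is otherwise a
  -- constant multiple of `g u`: reweighted sums become counts of survivors.
  reweight-𝟙 : ∀ {k} {C : A → B → Set} D (C? : ∀ u z → Dec (C u z)) (g : A → ℕ) (s : Vec B k) u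
    (all? : Dec (∀ j → C u (lookup s j))) →
    reweight D (λ u z → 𝟙 (C? u z)) g s u ≡ D ^ k * (𝟙 all? * g u)
  reweight-𝟙 D C? g [] u all? = sym (trans (*-identityˡ _)
    (trans (cong (_* g u) (𝟙-yes all? λ ())) (*-identityˡ (g u))))
  reweight-𝟙 {k = suc k} {C} D C? g (z ∷ s) u all? = begin
    reweight D (λ u z → 𝟙 (C? u z)) (λ u → g u * (D * 𝟙 (C? u z))) s u
      ≡⟨ reweight-𝟙 D C? _ s u all?′ ⟩
    D ^ k * (𝟙 all?′ * (g u * (D * 𝟙 (C? u z))))
      ≡⟨ rearrange (D ^ k) (𝟙 all?′) (g u) D (𝟙 (C? u z)) ⟩
    D ^ suc k * (𝟙 (C? u z) * 𝟙 all?′ * g u)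
      ≡⟨ cong (λ c → D ^ suc k * (c * g u)) (trans (sym (𝟙-× (C? u z) all?′)) (𝟙-cong (C? u z ×-dec all?′) all?
           (λ { (c , cs) zero → c ; (c , cs) (suc j) → cs j }) (λ cs → cs zero , cs ∘ suc))) ⟩
    D ^ suc k * (𝟙 all? * g u) ∎
    where
    open ≡-Reasoning
    all?′ : Dec (∀ j → C u (lookup s j))
    all?′ = Fin.all? (λ j → C? u (lookup s j))
    rearrange : ∀ a b c d e → a * (b * (c * (d * e))) ≡ d * a * (e * b * c)
    rearrange = solve-∀

  -- Homomorphism counts and the removal of one vertex of H

  IsHom : ∀ {r n} → Graph (Fin r) → Graph (Fin n) → Vec (Fin n) r → Set
  IsHom H G φ = ∀ i j → i H.~ j → lookup φ i G.~ lookup φ j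
    where
    module G = Graph G
    module H = Graph H

  isHom? : ∀ {r n} (H : Graph (Fin r)) (G : Graph (Fin n)) φ → Dec (IsHom H G φ)
  isHom? H G φ = Fin.all? λ i → Fin.all? λ j → (i H.~? j) →-dec (lookup φ i G.~? lookup φ j)
    where
    module G = Graph G
    module H = Graph H

  #hom : ∀ {r n} → Graph (Fin r) → Graph (Fin n) → (Fin r → List (Fin n)) → ℕ
  #hom H G V = ∑ (box V) (λ φ → 𝟙 (isHom? H G φ))

  deleteZero : ∀ {r} → Graph (Fin (suc r)) → Graph (Fin r)
  deleteZero H = record
    { _~_   = λ i j → suc i H.~ suc j
    ; _~?_  = λ i j → suc i H.~? suc j
    ; ~-sym = H.~-sym
    ; ~-irr = H.~-irr
    }
    where module H = Graph H

  module BlowUpZero {n r} (G : Graph (Fin n)) (H : Graph (Fin (suc r))) (triangleFree : TriangleFree H) where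

    private
      module G = Graph G
      module H = Graph H

    -- A tuple u of candidates for the neighbours of zero is paired with z = (y , ψ): an image y of zero and a
    -- tuple ψ for the other vertices. Both u and ψ are indexed by all of Fin r; the coordinates of u far from
    -- zero and those of ψ near zero are free and multiply every count by the same constant.
    Near : Fin r → Set
    Near i = zero H.~ suc i

    near : Fin r → Bool
    near i = does (zero H.~? suc i)

    lookup-mix-near : ∀ {i} (u ψ : Vec (Fin n) r) → Near i → lookup (mix near u ψ) i ≡ lookup u i
    lookup-mix-near {i} u ψ 0~i = trans (lookup-mix near u ψ i)
      (cong (if_then lookup u i else lookup ψ i) (dec-true (zero H.~? suc i) 0~i))

    lookup-mix-far : ∀ {i} (u ψ : Vec (Fin n) r) → ¬ Near i → lookup (mix near u ψ) i ≡ lookup ψ i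
    lookup-mix-far {i} u ψ 0≁i = trans (lookup-mix near u ψ i)
      (cong (if_then lookup u i else lookup ψ i) (dec-false (zero H.~? suc i) 0≁i))

    Valid : Fin n × Vec (Fin n) r → Set
    Valid (y , ψ) = ∀ i j → ¬ Near i → ¬ Near j → suc i H.~ suc j → lookup ψ i G.~ lookup ψ j

    valid? : ∀ z → Dec (Valid z)
    valid? (y , ψ) = Fin.all? λ i → Fin.all? λ j → ¬? (zero H.~? suc i) →-dec
      (¬? (zero H.~? suc j) →-dec ((suc i H.~? suc j) →-dec (lookup ψ i G.~? lookup ψ j)))

    -- The demands of `z` on a tuple split into one demand per coordinate, so the tuples joined to
    -- several `z` again form a box. Triangle-freeness makes these demands sufficient, as no edge
    -- relates two coordinates near zero. Far coordinates face no demand, and their candidate lists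
    -- do not shrink.
    Compatible : Fin n × Vec (Fin n) r → Fin r → Fin n → Set
    Compatible (y , ψ) i x = Near i →
      y G.~ x × (∀ j → ¬ Near j → suc i H.~ suc j → x G.~ lookup ψ j)

    compatible? : ∀ z i x → Dec (Compatible z i x)
    compatible? (y , ψ) i x = (zero H.~? suc i) →-dec ((y G.~? x) ×-dec
      (Fin.all? λ j → ¬? (zero H.~? suc j) →-dec ((suc i H.~? suc j) →-dec (x G.~? lookup ψ j))))

    Joins : Vec (Fin n) r → Fin n × Vec (Fin n) r → Set
    Joins u z = ∀ i → Compatible z i (lookup u i)

    joins? : ∀ u z → Dec (Joins u z)
    joins? u z = Fin.all? λ i → compatible? z i (lookup u i)

    isHom⇒valid : ∀ {u y ψ} → IsHom H G (y ∷ mix near u ψ) → Valid (y , ψ)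
    isHom⇒valid {u} {y} {ψ} hom i j 0≁i 0≁j i~j = subst₂ G._~_
      (lookup-mix-far u ψ 0≁i) (lookup-mix-far u ψ 0≁j) (hom (suc i) (suc j) i~j)

    isHom⇒joins : ∀ {u y ψ} → IsHom H G (y ∷ mix near u ψ) → Joins u (y , ψ)
    isHom⇒joins {u} {y} {ψ} hom i 0~i =
      subst (y G.~_) (lookup-mix-near u ψ 0~i) (hom zero (suc i) 0~i) ,
      λ j 0≁j i~j → subst₂ G._~_ (lookup-mix-near u ψ 0~i) (lookup-mix-far u ψ 0≁j) (hom (suc i) (suc j) i~j)

    -- As H has no triangle, no edge joins two neighbours of zero: every edge has an endpoint taken from ψ.
    joins⇒isHom : ∀ {u y ψ} → Valid (y , ψ) → Joins u (y , ψ) → IsHom (deleteZero H) G (mix near u ψ)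
    joins⇒isHom {u} {y} {ψ} valid joins i j i~j with zero H.~? suc i | zero H.~? suc j
    ... | yes 0~i | yes 0~j = contradiction (0~i , i~j , H.~-sym 0~j) (triangleFree zero (suc i) (suc j))
    ... | yes 0~i | no  0≁j = subst₂ G._~_ (sym (lookup-mix-near u ψ 0~i)) (sym (lookup-mix-far u ψ 0≁j))
      (proj₂ (joins i 0~i) j 0≁j i~j)
    ... | no  0≁i | yes 0~j = subst₂ G._~_ (sym (lookup-mix-far u ψ 0≁i)) (sym (lookup-mix-near u ψ 0~j))
      (G.~-sym (proj₂ (joins j 0~j) i 0≁i (H.~-sym i~j)))
    ... | no  0≁i | no  0≁j = subst₂ G._~_ (sym (lookup-mix-far u ψ 0≁i)) (sym (lookup-mix-far u ψ 0≁j))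
      (valid i j 0≁i 0≁j i~j)

    module Dense (V : Fin (suc r) → List (Fin n)) (V! : ∀ i → Unique (V i)) (Y : List (Fin n)) (k e : ℕ)
      (0<|V₀| : 0 < length (V zero)) (0<|U| : 0 < length (box (V ∘ suc)))
      (room : 2 ^ (2 + e) * (k + length Y) ≤ length (V zero))
      (dense : length (box V) ≤ 2 ^ e * #hom H G V) where

      private
        D T M L : ℕ
        -- `D` is `4 * T`: one factor 2 separates good tuples from the mean density `1 / T`, the
        -- other pays for skipping used vertices.
        D = 2 ^ (2 + e)
        T = 2 ^ e
        M = length (V zero) * length (box (V ∘ suc))
        L = k + length Y

        U : List (Vec (Fin n) r)
        U = box (V ∘ suc)
        Z : List (Fin n × Vec (Fin n) r)
        Z = filter valid? (cartesianProduct (V zero) U)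

        joined : Vec (Fin n) r → Fin n × Vec (Fin n) r → ℕ
        joined u z = 𝟙 (joins? u z)

        weight : Vec (Fin n) r → ℕ
        weight u = ∑ Z (joined u)

        good? : ∀ u → Dec (M ≤ 2 * T * weight u)
        good? u = M ≤? 2 * T * weight u
        bad? : ∀ u → Dec (D * weight u ≤ M)
        bad? u = D * weight u ≤? M

        0<M : 0 < M
        0<M = *-mono-≤ 0<|V₀| 0<|U|

        |Z|≤M : length Z ≤ M
        |Z|≤M = ≤-trans (List.length-filter valid? (cartesianProduct (V zero) U))
          (≤-reflexive (trans (sym (∑-1 (cartesianProduct (V zero) U)))
          (trans (∑-cartesianProductWith _,_ (V zero) U _)
          (trans (∑-const (V zero) _) (cong (length (V zero) *_) (∑-1 U))))))

        weight≤M : ∀ u → weight u ≤ M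
        weight≤M u = ≤-trans (∑-mono Z (λ z → 𝟙≤1 (joins? u z))) (≤-trans (≤-reflexive (∑-1 Z)) |Z|≤M)

        ∑-Z : ∀ (f : Fin n × Vec (Fin n) r → ℕ) → ∑ Z f ≡ ∑ (V zero) (λ y → ∑ U (λ ψ → 𝟙 (valid? (y , ψ)) * f (y , ψ)))
        ∑-Z f = trans (∑-filter valid? (cartesianProduct (V zero) U) f)
          (∑-cartesianProductWith _,_ (V zero) U _)

        isHom≤ : ∀ u y ψ → 𝟙 (isHom? H G (y ∷ mix near u ψ)) ≤ 𝟙 (valid? (y , ψ)) * joined u (y , ψ)
        isHom≤ u y ψ = ≤-trans
          (𝟙-mono (isHom? H G (y ∷ mix near u ψ)) (valid? (y , ψ) ×-dec joins? u (y , ψ))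
            (λ hom → isHom⇒valid {u} {y} {ψ} hom , isHom⇒joins {u} {y} {ψ} hom))
          (≤-reflexive (𝟙-× (valid? (y , ψ)) (joins? u (y , ψ))))

        ≤isHom : ∀ u y ψ → 𝟙 (valid? (y , ψ)) * joined u (y , ψ) ≤ 𝟙 (isHom? (deleteZero H) G (mix near u ψ))
        ≤isHom u y ψ = ≤-trans (≤-reflexive (sym (𝟙-× (valid? (y , ψ)) (joins? u (y , ψ)))))
          (𝟙-mono (valid? (y , ψ) ×-dec joins? u (y , ψ)) (isHom? (deleteZero H) G (mix near u ψ))
            (λ { (valid , joins) → joins⇒isHom {u} {y} {ψ} valid joins }))

        -- Each tuple `y ∷ φ` arises as `y ∷ mix near u ψ` from `length U` pairs `(u , ψ)`, counted
        -- with multiplicity.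
        ∑-weight : length U * #hom H G V ≤ ∑ U weight
        ∑-weight = begin
          length U * #hom H G V
            ≡⟨ cong (length U *_) (∑-box V _) ⟩
          length U * ∑ (V zero) (λ y → ∑ U (λ u → 𝟙 (isHom? H G (y ∷ u))))
            ≡⟨ ∑-*ˡ (V zero) (length U) _ ⟨
          ∑ (V zero) (λ y → length U * ∑ U (λ u → 𝟙 (isHom? H G (y ∷ u))))
            ≡⟨ ∑-cong (V zero) (λ y → ∑-mix near (V ∘ suc) (V ∘ suc) (λ u → 𝟙 (isHom? H G (y ∷ u))) (λ _ _ → refl)) ⟨
          ∑ (V zero) (λ y → ∑ U (λ u → ∑ U (λ ψ → 𝟙 (isHom? H G (y ∷ mix near u ψ)))))
            ≤⟨ ∑-mono (V zero) (λ y → ∑-mono U (λ u → ∑-mono U (λ ψ → isHom≤ u y ψ))) ⟩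
          ∑ (V zero) (λ y → ∑ U (λ u → ∑ U (λ ψ → 𝟙 (valid? (y , ψ)) * joined u (y , ψ))))
            ≡⟨ ∑-swap (V zero) U _ ⟩
          ∑ U (λ u → ∑ (V zero) (λ y → ∑ U (λ ψ → 𝟙 (valid? (y , ψ)) * joined u (y , ψ))))
            ≡⟨ ∑-cong U (λ u → ∑-Z (joined u)) ⟨
          ∑ U weight ∎
          where open ≤-Reasoning

        -- Reverse Markov inequality: `weight` has mean at least `M / T` and maximum at most `M`,
        -- and the tuples that are not good account for less than half of that mean. The term
        -- `M * length U` is added on both sides to avoid subtraction.
        many-good : length U ≤ 2 * T * ∑ U (λ u → 𝟙 (good? u))
        many-good = *-cancelˡ-≤ M {{>-nonZero 0<M}} (+-cancelʳ-≤ (M * length U) _ _ (begin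
          M * length U + M * length U
            ≡⟨ double (M * length U) ⟩
          2 * (M * length U)
            ≤⟨ *-monoʳ-≤ 2 (*-monoˡ-≤ (length U) (≤-trans (≤-reflexive (sym (length-box V))) dense)) ⟩
          2 * (T * #hom H G V * length U)
            ≡⟨ rearrange T (#hom H G V) (length U) ⟩
          2 * T * (length U * #hom H G V)
            ≤⟨ *-monoʳ-≤ (2 * T) ∑-weight ⟩
          2 * T * ∑ U weight
            ≡⟨ ∑-*ˡ U (2 * T) weight ⟨
          ∑ U (λ u → 2 * T * weight u)
            ≤⟨ ∑-mono U (λ u → split u (good? u)) ⟩
          ∑ U (λ u → M * (2 * T) * 𝟙 (good? u) + M)
            ≡⟨ ∑-+ U _ _ ⟩
          ∑ U (λ u → M * (2 * T) * 𝟙 (good? u)) + ∑ U (λ _ → M)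
            ≡⟨ cong₂ _+_ (∑-*ˡ U (M * (2 * T)) _) (trans (∑-const U M) (*-comm (length U) M)) ⟩
          M * (2 * T) * ∑ U (λ u → 𝟙 (good? u)) + M * length U
            ≡⟨ cong (_+ M * length U) (*-assoc M (2 * T) _) ⟩
          M * (2 * T * ∑ U (λ u → 𝟙 (good? u))) + M * length U ∎))
          where
          open ≤-Reasoning
          double : ∀ a → a + a ≡ 2 * a
          double = solve-∀
          rearrange : ∀ a b c → 2 * (a * b * c) ≡ 2 * a * (c * b)
          rearrange = solve-∀
          split : ∀ u (P? : Dec (M ≤ 2 * T * weight u)) → 2 * T * weight u ≤ M * (2 * T) * 𝟙 P? + M
          split u (yes _) = ≤-trans (*-monoʳ-≤ (2 * T) (weight≤M u))
            (≤-trans (≤-reflexive (trans (*-comm (2 * T) M) (sym (*-identityʳ _)))) (m≤m+n _ M))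
          split u (no ¬p) = ≤-trans (<⇒≤ (≰⇒> ¬p)) (m≤n+m M _)

        -- The factor `D` on the good indicator makes up for good tuples being only a fraction
        -- `1 / (2 * T)` of `U`. It yields `2 * length U`: one half covers all bad tuples, the other
        -- is the surplus.
        initially : ∑ U (λ u → 𝟙 (bad? u)) + length U ≤ ∑ U (λ u → D * 𝟙 (good? u))
        initially = begin
          ∑ U (λ u → 𝟙 (bad? u)) + length U
            ≤⟨ +-monoˡ-≤ (length U) (≤-trans (∑-mono U (λ u → 𝟙≤1 (bad? u))) (≤-reflexive (∑-1 U))) ⟩
          length U + length U
            ≡⟨ cong (length U +_) (+-identityʳ (length U)) ⟨
          2 * length U
            ≤⟨ *-monoʳ-≤ 2 many-good ⟩
          2 * (2 * T * ∑ U (λ u → 𝟙 (good? u)))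
            ≡⟨ *-assoc 2 (2 * T) _ ⟨
          D * ∑ U (λ u → 𝟙 (good? u))
            ≡⟨ ∑-*ˡ U D _ ⟨
          ∑ U (λ u → D * 𝟙 (good? u)) ∎
          where open ≤-Reasoning

        fresh-Z? : ∀ Y (z : Fin n × Vec (Fin n) r) → Dec (proj₁ z ∉ Y)
        fresh-Z? = fresh? proj₁

        -- `V zero` has no repetitions, so at most `length Y` of its entries lie in `Y`, and each is
        -- paired with at most `length U` tuples `ψ`.
        stale-few : ∀ Y → ∑ Z (λ z → 𝟙 (¬? (fresh-Z? Y z))) ≤ length Y * length U
        stale-few Y = begin
          ∑ Z (λ z → 𝟙 (¬? (fresh-Z? Y z)))
            ≤⟨ ∑-filter-≤ valid? (cartesianProduct (V zero) U) _ ⟩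
          ∑ (cartesianProduct (V zero) U) (λ z → 𝟙 (¬? (fresh-Z? Y z)))
            ≡⟨ ∑-cartesianProductWith _,_ (V zero) U _ ⟩
          ∑ (V zero) (λ y → ∑ U (λ ψ → 𝟙 (¬? (fresh-Z? Y (y , ψ)))))
            ≡⟨ ∑-cong (V zero) (λ y → trans (∑-const U _) (*-comm (length U) _)) ⟩
          ∑ (V zero) (λ y → 𝟙 (stale? y) * length U)
            ≡⟨ ∑-filter stale? (V zero) (λ _ → length U) ⟨
          ∑ (filter stale? (V zero)) (λ _ → length U)
            ≡⟨ ∑-const (filter stale? (V zero)) (length U) ⟩
          length (filter stale? (V zero)) * length U
            ≤⟨ *-monoˡ-≤ (length U) (length-Unique-⊆ Fin._≟_ (Unique.filter⁺ stale? (V! zero)) filter⊆Y) ⟩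
          length Y * length U ∎
          where
          open ≤-Reasoning
          stale? = λ y → ¬? (¬? (member? Fin._≟_ y Y))
          filter⊆Y : ∀ {y} → y ∈ filter stale? (V zero) → y ∈ Y
          filter⊆Y {y} y∈ = decidable-stable (member? Fin._≟_ y Y) (proj₂ (∈-filter⁻ stale? {xs = V zero} y∈))

        weight≤fresh+stale : ∀ Y u → weight u ≤ ∑ (filter (fresh-Z? Y) Z) (joined u) + length Y * length U
        weight≤fresh+stale Y u = begin
          ∑ Z (joined u)
            ≤⟨ ∑-mono Z (λ z → split (fresh-Z? Y z) (𝟙≤1 (joins? u z))) ⟩
          ∑ Z (λ z → 𝟙 (fresh-Z? Y z) * joined u z + 𝟙 (¬? (fresh-Z? Y z)))
            ≡⟨ ∑-+ Z _ _ ⟩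
          ∑ Z (λ z → 𝟙 (fresh-Z? Y z) * joined u z) + ∑ Z (λ z → 𝟙 (¬? (fresh-Z? Y z)))
            ≤⟨ +-mono-≤ (≤-reflexive (sym (∑-filter (fresh-Z? Y) Z (joined u)))) (stale-few Y) ⟩
          ∑ (filter (fresh-Z? Y) Z) (joined u) + length Y * length U ∎
          where
          open ≤-Reasoning
          split : (P? : Dec P) {a : ℕ} → a ≤ 1 → a ≤ 𝟙 P? * a + 𝟙 (¬? P?)
          split (yes _) {a} _   = ≤-reflexive (sym (trans (+-identityʳ _) (+-identityʳ a)))
          split (no  _) {a} a≤1 = a≤1

        -- A good tuple has `D * weight u` at least `2 * M`, and by `room` the skipped labels
        -- account for at most `M` of it.
        good-heavy : ∀ u → 0 < D * 𝟙 (good? u) → ∀ Y → length Y ≤ L → M ≤ D * ∑ (filter (fresh-Z? Y) Z) (joined u)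
        good-heavy u 0<good Y |Y|≤L = +-cancelʳ-≤ M _ _ (begin
          M + M
            ≡⟨ cong (M +_) (+-identityʳ M) ⟨
          2 * M
            ≤⟨ *-monoʳ-≤ 2 (𝟙-positive (good? u) (0<n D 0<good)) ⟩
          2 * (2 * T * weight u)
            ≡⟨ *-assoc 2 (2 * T) _ ⟨
          D * weight u
            ≤⟨ *-monoʳ-≤ D (weight≤fresh+stale Y u) ⟩
          D * (∑ (filter (fresh-Z? Y) Z) (joined u) + length Y * length U)
            ≡⟨ *-distribˡ-+ D _ _ ⟩
          D * ∑ (filter (fresh-Z? Y) Z) (joined u) + D * (length Y * length U)
            ≤⟨ +-monoʳ-≤ (D * ∑ (filter (fresh-Z? Y) Z) (joined u))
                 (≤-trans (≤-reflexive (sym (*-assoc D (length Y) _)))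
                 (*-monoˡ-≤ (length U) (≤-trans (*-monoʳ-≤ D |Y|≤L) room))) ⟩
          D * ∑ (filter (fresh-Z? Y) Z) (joined u) + M ∎)
          where
          open ≤-Reasoning
          0<n : ∀ m {n} → 0 < m * n → 0 < n
          0<n m {zero}  0<m*0 = ≤-trans 0<m*0 (≤-reflexive (*-zeroʳ m))
          0<n m {suc n} _     = s≤s z≤n

        selected = reweighting {D = D} U Z joined 0<|U| 0<M {L = L} proj₁ k Y
          (λ u → 𝟙 (bad? u)) (λ u → D * 𝟙 (good? u)) |Z|≤M ≤-refl good-heavy
          (λ u 0<bad → 𝟙-positive (bad? u) 0<bad) initially

        s : Vec (Fin n × Vec (Fin n) r) k
        s = proj₁ selected

        Survives : Fin r → Fin n → Set
        Survives i x = ∀ j → Compatible (lookup s j) i x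

        survives? : ∀ i x → Dec (Survives i x)
        survives? i x = Fin.all? λ j → compatible? (lookup s j) i x

      V′ : Fin r → List (Fin n)
      V′ i = filter (survives? i) (V (suc i))

      private
        joinsAll? : ∀ u → Dec (∀ j → Joins u (lookup s j))
        joinsAll? u = Fin.all? λ j → joins? u (lookup s j)
        survivesAll? : ∀ u → Dec (∀ i → Survives i (lookup u i))
        survivesAll? u = Fin.all? λ i → survives? i (lookup u i)

        ∑-reweight : ∀ g → ∑ U (reweight D joined g s) ≡ D ^ k * ∑ (box V′) g
        ∑-reweight g = begin
          ∑ U (reweight D joined g s)
            ≡⟨ ∑-cong U (λ u → reweight-𝟙 D joins? g s u (joinsAll? u)) ⟩
          ∑ U (λ u → D ^ k * (𝟙 (joinsAll? u) * g u))
            ≡⟨ ∑-*ˡ U (D ^ k) _ ⟩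
          D ^ k * ∑ U (λ u → 𝟙 (joinsAll? u) * g u)
            ≡⟨ cong (D ^ k *_) (∑-cong U λ u → cong (_* g u)
                 (𝟙-cong (joinsAll? u) (survivesAll? u) (λ p i j → p j i) (λ p j i → p i j))) ⟩
          D ^ k * ∑ U (λ u → 𝟙 (survivesAll? u) * g u)
            ≡⟨ cong (D ^ k *_) (∑-box-filter survives? survivesAll? (V ∘ suc) g) ⟨
          D ^ k * ∑ (box V′) g ∎
          where open ≡-Reasoning

        -- Both conclusions come from this inequality: dropping the bad sum gives `V′-large`, and
        -- dropping `length U` bounds the bad survivors by `D` times the good ones, whence
        -- `|V′|≤not-bad`.
        finally : D ^ k * ∑ (box V′) (λ u → 𝟙 (bad? u)) + length U ≤ D ^ suc k * ∑ (box V′) (λ u → 𝟙 (good? u))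
        finally = begin
          D ^ k * ∑ (box V′) (λ u → 𝟙 (bad? u)) + length U
            ≡⟨ cong (_+ length U) (∑-reweight _) ⟨
          ∑ U (reweight D joined (λ u → 𝟙 (bad? u)) s) + length U
            ≤⟨ proj₂ (proj₂ (proj₂ (proj₂ selected))) ⟩
          ∑ U (reweight D joined (λ u → D * 𝟙 (good? u)) s)
            ≡⟨ ∑-reweight _ ⟩
          D ^ k * ∑ (box V′) (λ u → D * 𝟙 (good? u))
            ≡⟨ cong (D ^ k *_) (∑-*ˡ (box V′) D _) ⟩
          D ^ k * (D * ∑ (box V′) (λ u → 𝟙 (good? u)))
            ≡⟨ rearrange (D ^ k) D _ ⟩
          D ^ suc k * ∑ (box V′) (λ u → 𝟙 (good? u)) ∎
          where
          open ≤-Reasoning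
          rearrange : ∀ a b c → a * (b * c) ≡ b * a * c
          rearrange = solve-∀

        not-bad : ℕ
        not-bad = ∑ (box V′) (λ u → 𝟙 (¬? (bad? u)))

        good≤not-bad : ∑ (box V′) (λ u → 𝟙 (good? u)) ≤ not-bad
        good≤not-bad = ∑-mono (box V′) λ u → 𝟙-mono (good? u) (¬? (bad? u)) λ good bad →
          <⇒≱ (m<m+n M 0<M) (≤-trans (≤-reflexive (cong (M +_) (sym (+-identityʳ M))))
            (≤-trans (*-monoʳ-≤ 2 good) (≤-trans (≤-reflexive (sym (*-assoc 2 (2 * T) _))) bad)))

        |V′|≤not-bad : length (box V′) ≤ suc D * not-bad
        |V′|≤not-bad = begin
          length (box V′)
            ≡⟨ ∑-1 (box V′) ⟨
          ∑ (box V′) (λ _ → 1)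
            ≡⟨ ∑-cong (box V′) (λ u → 𝟙-¬ (bad? u)) ⟨
          ∑ (box V′) (λ u → 𝟙 (bad? u) + 𝟙 (¬? (bad? u)))
            ≡⟨ ∑-+ (box V′) _ _ ⟩
          ∑ (box V′) (λ u → 𝟙 (bad? u)) + not-bad
            ≤⟨ +-monoˡ-≤ not-bad (*-cancelˡ-≤ (D ^ k) {{m^n≢0 D k {{m^n≢0 2 (2 + e)}}}}
                 (≤-trans (m≤m+n _ (length U)) (≤-trans finally (≤-trans
                   (*-monoʳ-≤ (D ^ suc k) good≤not-bad) (≤-reflexive (rearrange D (D ^ k) not-bad)))))) ⟩
          D * not-bad + not-bad
            ≡⟨ +-comm (D * not-bad) not-bad ⟩
          suc D * not-bad ∎
          where
          open ≤-Reasoning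
          rearrange : ∀ a b c → a * b * c ≡ b * (a * c)
          rearrange = solve-∀

        V′-far : ∀ i → near i ≡ false → V′ i ≡ V (suc i)
        V′-far i far = List.filter-all (survives? i) (All.universal survives (V (suc i)))
          where
          survives : ∀ x → Survives i x
          survives x j 0~i = contradiction (trans (sym far) (dec-true (zero H.~? suc i) 0~i)) λ ()

        -- A tuple that is not bad has more than `M / D` extensions, and each restricts to a
        -- homomorphism of `deleteZero H`. Forgetting `y` loses a factor `length (V zero)`, and the
        -- free coordinates of `u` and `ψ` lose `length U`; together this is `M`.
        not-bad≤#hom : not-bad ≤ D * #hom (deleteZero H) G V′
        not-bad≤#hom = *-cancelˡ-≤ M {{>-nonZero 0<M}} (begin
          M * not-bad
            ≡⟨ ∑-*ˡ (box V′) M _ ⟨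
          ∑ (box V′) (λ u → M * 𝟙 (¬? (bad? u)))
            ≤⟨ ∑-mono (box V′) (λ u → markov u (bad? u)) ⟩
          ∑ (box V′) (λ u → D * weight u)
            ≡⟨ ∑-*ˡ (box V′) D weight ⟩
          D * ∑ (box V′) weight
            ≡⟨ cong (D *_) (∑-cong (box V′) (λ u → ∑-Z (joined u))) ⟩
          D * ∑ (box V′) (λ u → ∑ (V zero) (λ y → ∑ U (λ ψ → 𝟙 (valid? (y , ψ)) * joined u (y , ψ))))
            ≤⟨ *-monoʳ-≤ D (∑-mono (box V′) (λ u → ∑-mono (V zero) (λ y → ∑-mono U (≤isHom u y)))) ⟩
          D * ∑ (box V′) (λ u → ∑ (V zero) (λ _ → ∑ U (λ ψ → 𝟙 (isHom? (deleteZero H) G (mix near u ψ)))))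
            ≡⟨ cong (D *_) (∑-cong (box V′) (λ u → ∑-const (V zero) _)) ⟩
          D * ∑ (box V′) (λ u → length (V zero) * ∑ U (λ ψ → 𝟙 (isHom? (deleteZero H) G (mix near u ψ))))
            ≡⟨ cong (D *_) (∑-*ˡ (box V′) (length (V zero)) _) ⟩
          D * (length (V zero) * ∑ (box V′) (λ u → ∑ U (λ ψ → 𝟙 (isHom? (deleteZero H) G (mix near u ψ)))))
            ≡⟨ cong (λ c → D * (length (V zero) * c)) (∑-mix near (V ∘ suc) V′ _ V′-far) ⟩
          D * (length (V zero) * (length U * #hom (deleteZero H) G V′))
            ≡⟨ rearrange D (length (V zero)) (length U) _ ⟩
          M * (D * #hom (deleteZero H) G V′) ∎)
          where
          open ≤-Reasoning
          rearrange : ∀ a b c d → a * (b * (c * d)) ≡ b * c * (a * d)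
          rearrange = solve-∀
          markov : ∀ u (P? : Dec (D * weight u ≤ M)) → M * 𝟙 (¬? P?) ≤ D * weight u
          markov u (yes _)    = ≤-trans (≤-reflexive (*-zeroʳ M)) z≤n
          markov u (no  ¬bad) = ≤-trans (≤-reflexive (*-identityʳ M)) (<⇒≤ (≰⇒> ¬bad))

      blocks : Vec (Fin n) k
      blocks = Vec.map proj₁ s

      blocks∈V₀ : ∀ j → lookup blocks j ∈ V zero
      blocks∈V₀ j = subst (_∈ V zero) (sym (lookup-map j proj₁ s)) (proj₁ (∈-cartesianProduct⁻ (V zero) U
        (proj₁ (∈-filter⁻ valid? {xs = cartesianProduct (V zero) U} (VecAll.lookup⁺ (proj₁ (proj₂ selected)) j)))))

      blocks∉Y : ∀ j → lookup blocks j ∉ Y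
      blocks∉Y = VecAll.lookup⁺ (proj₁ (proj₂ (proj₂ selected)))

      blocks-injective : ∀ i j → lookup blocks i ≡ lookup blocks j → i ≡ j
      blocks-injective = VecUnique.lookup-injective (proj₁ (proj₂ (proj₂ (proj₂ selected))))

      V′! : ∀ i → Unique (V′ i)
      V′! i = Unique.filter⁺ (survives? i) (V! (suc i))

      V′⊆V : ∀ i {x} → x ∈ V′ i → x ∈ V (suc i)
      V′⊆V i x∈V′ = proj₁ (∈-filter⁻ (survives? i) {xs = V (suc i)} x∈V′)

      |V′ᵢ|≤|Vᵢ| : ∀ i → length (V′ i) ≤ length (V (suc i))
      |V′ᵢ|≤|Vᵢ| i = List.length-filter (survives? i) (V (suc i))

      blocks~V′ : ∀ i j {x} → Near i → x ∈ V′ i → lookup blocks j G.~ x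
      blocks~V′ i j {x} 0~i x∈V′ = subst (G._~ x) (sym (lookup-map j proj₁ s))
        (proj₁ (proj₂ (∈-filter⁻ (survives? i) {xs = V (suc i)} x∈V′) j 0~i))

      V′-large : length (box (V ∘ suc)) ≤ (2 ^ (2 + e)) ^ suc k * length (box V′)
      V′-large = ≤-trans (m≤n+m _ (D ^ k * ∑ (box V′) (λ u → 𝟙 (bad? u)))) (≤-trans finally
        (*-monoʳ-≤ (D ^ suc k) (≤-trans (∑-mono (box V′) (λ u → 𝟙≤1 (good? u))) (≤-reflexive (∑-1 (box V′))))))

      V′-dense : length (box V′) ≤ 2 ^ (5 + (e + e)) * #hom (deleteZero H) G V′
      V′-dense = begin
        length (box V′)
          ≤⟨ |V′|≤not-bad ⟩
        suc D * not-bad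
          -- Here `suc D` is at most `2 * D`, so the loss is `2 * D * D`, which is `32 * (T * T)`:
          -- the origin of the exponent `5 + (e + e)`.
          ≤⟨ *-mono-≤ (+-monoˡ-≤ D (m^n>0 2 (2 + e))) not-bad≤#hom ⟩
        (D + D) * (D * #hom (deleteZero H) G V′)
          ≡⟨ rearrange T (#hom (deleteZero H) G V′) ⟩
        32 * (T * T) * #hom (deleteZero H) G V′
          ≡⟨ cong (_* #hom (deleteZero H) G V′) (trans (cong (32 *_) (sym (^-distribˡ-+-* 2 e e)))
               (sym (^-distribˡ-+-* 2 5 (e + e)))) ⟩
        2 ^ (5 + (e + e)) * #hom (deleteZero H) G V′ ∎
        where
        open ≤-Reasoning
        rearrange : ∀ t c → (2 * (2 * t) + 2 * (2 * t)) * (2 * (2 * t) * c) ≡ 32 * (t * t) * c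
        rearrange = solve-∀

  -- Iteration over the vertices of H

  0<m*n⇒0<m×0<n : ∀ m n → 0 < m * n → 0 < m × 0 < n
  0<m*n⇒0<m×0<n (suc m) (suc n) _ = s≤s z≤n , s≤s z≤n
  0<m*n⇒0<m×0<n (suc m) zero    0<m*0 = contradiction (≤-trans 0<m*0 (≤-reflexive (*-zeroʳ m))) λ ()

  length-box-mono : ∀ {r} (V W : Fin r → List A) → (∀ i → length (W i) ≤ length (V i)) → length (box W) ≤ length (box V)
  length-box-mono {r = zero}  V W W≤V = ≤-refl
  length-box-mono {r = suc r} V W W≤V = subst₂ _≤_ (sym (length-box W)) (sym (length-box V))
    (*-mono-≤ (W≤V zero) (length-box-mono (V ∘ suc) (W ∘ suc) (W≤V ∘ suc)))

  length-box-positive : ∀ {r} (V : Fin r → List A) → (∀ i → 0 < length (V i)) → 0 < length (box V)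
  length-box-positive {r = zero}  V 0<V = s≤s z≤n
  length-box-positive {r = suc r} V 0<V = subst (0 <_) (sym (length-box V))
    (*-mono-≤ (0<V zero) (length-box-positive (V ∘ suc) (0<V ∘ suc)))

  -- No part grows, so the factor lost by a single part is at most the factor lost by the whole box.
  length-box-factor : ∀ {r} (V W : Fin r → List A) c → (∀ i → length (W i) ≤ length (V i)) →
    0 < length (box V) → length (box V) ≤ c * length (box W) → ∀ i → length (V i) ≤ c * length (W i)
  length-box-factor {r = suc r} V W c W≤V 0<V V≤cW i = factor i
    where
    open ≤-Reasoning
    v w v′ w′ : ℕ
    v = length (V zero)
    w = length (W zero)
    v′ = length (box (V ∘ suc))
    w′ = length (box (W ∘ suc))
    0<v = proj₁ (0<m*n⇒0<m×0<n v v′ (subst (0 <_) (length-box V) 0<V))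
    0<v′ = proj₂ (0<m*n⇒0<m×0<n v v′ (subst (0 <_) (length-box V) 0<V))
    vv′≤cww′ : v * v′ ≤ c * (w * w′)
    vv′≤cww′ = subst₂ (λ a b → a ≤ c * b) (length-box V) (length-box W) V≤cW
    rearrange : ∀ a b c → a * (b * c) ≡ b * (a * c)
    rearrange = solve-∀
    factor : ∀ i → length (V i) ≤ c * length (W i)
    factor zero = *-cancelʳ-≤ v (c * w) v′ {{>-nonZero 0<v′}} (begin
      v * v′        ≤⟨ vv′≤cww′ ⟩
      c * (w * w′)  ≤⟨ *-monoʳ-≤ c (*-monoʳ-≤ w (length-box-mono (V ∘ suc) (W ∘ suc) (W≤V ∘ suc))) ⟩
      c * (w * v′)  ≡⟨ *-assoc c w v′ ⟨
      c * w * v′    ∎)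
    factor (suc i) = length-box-factor (V ∘ suc) (W ∘ suc) c (W≤V ∘ suc) 0<v′
      (*-cancelˡ-≤ v {{>-nonZero 0<v}} (begin
        v * v′        ≤⟨ vv′≤cww′ ⟩
        c * (w * w′)  ≤⟨ *-monoʳ-≤ c (*-monoˡ-≤ w′ (W≤V zero)) ⟩
        c * (v * w′)  ≡⟨ rearrange c v w′ ⟩
        v * (c * w′)  ∎)) i

  -- The parts may overlap; in the application each starts as the whole vertex set. Disjointness
  -- from the blocks chosen earlier is therefore enforced by the list `Y` of their vertices.
  record BlowUp {r n} (H : Graph (Fin r)) (G : Graph (Fin n)) (k : ℕ) (V : Fin r → List (Fin n)) (Y : List (Fin n)) : Set where
    private
      module G = Graph G
      module H = Graph H
    field
      φ         : Fin r → Fin k → Fin n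
      φ∈V       : ∀ i s → φ i s ∈ V i
      φ∉Y       : ∀ i s → φ i s ∉ Y
      injective : ∀ i j s t → φ i s ≡ φ j t → i ≡ j × s ≡ t
      adjacent  : ∀ i j s t → i H.~ j → φ i s G.~ φ j t

  -- The parts V need 2 ^ threshold vertices for r rounds to succeed: each round avoids at most L used
  -- vertices, divides the parts by at most 2 ^ ((2 + e) (k + 1)), and replaces the density 2⁻ᵉ by 2⁻⁽⁵⁺²ᵉ⁾.
  threshold : (L k r e : ℕ) → ℕ
  threshold L k zero    e = 0
  threshold L k (suc r) e = (2 + e + L) + ((2 + e) * suc k + threshold L k r (5 + (e + e)))

  -- Membership in the parts belongs to the conclusion because later vertices inherit from it their
  -- adjacency to earlier blocks. The bound `r * k + length Y ≤ L` is invariant: each round moves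
  -- `k` from the first summand to the second.
  blowUp : ∀ {r n} (H : Graph (Fin r)) → TriangleFree H → (G : Graph (Fin n)) → ∀ L k e V Y →
    (∀ i → Unique (V i)) → r * k + length Y ≤ L → (∀ i → 2 ^ threshold L k r e ≤ length (V i)) →
    length (box V) ≤ 2 ^ e * #hom H G V → BlowUp H G k V Y
  blowUp {r = zero} H _ G L k e V Y V! |Y|≤L large dense = record
    { φ = λ () ; φ∈V = λ () ; φ∉Y = λ () ; injective = λ () ; adjacent = λ () }
  blowUp {r = suc r} {n} H triangleFree G L k e V Y V! |Y|≤L large dense = record
    { φ         = λ { zero → lookup S.blocks ; (suc i) → rest.φ i }
    ; φ∈V       = λ { zero → S.blocks∈V₀ ; (suc i) s → S.V′⊆V i (rest.φ∈V i s) }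
    ; φ∉Y       = λ { zero → S.blocks∉Y ; (suc i) s → rest.φ∉Y i s ∘ ∈-++⁺ʳ (toList S.blocks) }
    ; injective = λ where
        zero    zero    s t eq → refl , S.blocks-injective s t eq
        zero    (suc j) s t eq → contradiction (sym eq) (rest≢blocks j t s)
        (suc i) zero    s t eq → contradiction eq (rest≢blocks i s t)
        (suc i) (suc j) s t eq → let i≡j , s≡t = rest.injective i j s t eq in cong suc i≡j , s≡t
    ; adjacent  = λ where
        zero    zero    s t 0~0 → contradiction 0~0 H.~-irr
        zero    (suc j) s t 0~j → S.blocks~V′ j s 0~j (rest.φ∈V j t)
        (suc i) zero    s t i~0 → G.~-sym (S.blocks~V′ i t (H.~-sym i~0) (rest.φ∈V i s))
        (suc i) (suc j) s t i~j → rest.adjacent i j s t i~j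
    }
    where
    module G = Graph G
    module H = Graph H
    open ≤-Reasoning
    0<V : ∀ i → 0 < length (V i)
    0<V i = ≤-trans (m^n>0 2 (threshold L k (suc r) e)) (large i)
    |U|>0 = length-box-positive (V ∘ suc) (0<V ∘ suc)
    room : 2 ^ (2 + e) * (k + length Y) ≤ length (V zero)
    room = begin
      2 ^ (2 + e) * (k + length Y)  ≤⟨ *-monoʳ-≤ (2 ^ (2 + e)) (≤-trans (+-monoˡ-≤ (length Y) (m≤m+n k (r * k))) |Y|≤L) ⟩
      -- The crude bound `L ≤ 2 ^ L` is affordable: it adds `L` to an exponent that is of order `k`
      -- anyway.
      2 ^ (2 + e) * L               ≤⟨ *-monoʳ-≤ (2 ^ (2 + e)) (n≤2^n L) ⟩
      2 ^ (2 + e) * 2 ^ L           ≡⟨ ^-distribˡ-+-* 2 (2 + e) L ⟨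
      2 ^ (2 + e + L)               ≤⟨ ^-monoʳ-≤ 2 (m≤m+n (2 + e + L) _) ⟩
      2 ^ threshold L k (suc r) e   ≤⟨ large zero ⟩
      length (V zero)               ∎
    module S = BlowUpZero.Dense G H triangleFree V V! Y k e (0<V zero) |U|>0 room dense
    large′ : ∀ i → 2 ^ threshold L k r (5 + (e + e)) ≤ length (S.V′ i)
    large′ i = *-cancelˡ-≤ ((2 ^ (2 + e)) ^ suc k) {{m^n≢0 (2 ^ (2 + e)) (suc k) {{m^n≢0 2 (2 + e)}}}} (begin
      (2 ^ (2 + e)) ^ suc k * 2 ^ threshold L k r (5 + (e + e))
        ≡⟨ cong (_* 2 ^ threshold L k r (5 + (e + e))) (^-*-assoc 2 (2 + e) (suc k)) ⟩
      2 ^ ((2 + e) * suc k) * 2 ^ threshold L k r (5 + (e + e))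
        ≡⟨ ^-distribˡ-+-* 2 ((2 + e) * suc k) _ ⟨
      2 ^ ((2 + e) * suc k + threshold L k r (5 + (e + e)))
        ≤⟨ ^-monoʳ-≤ 2 (m≤n+m _ (2 + e + L)) ⟩
      2 ^ threshold L k (suc r) e
        ≤⟨ large (suc i) ⟩
      length (V (suc i))
        ≤⟨ length-box-factor (V ∘ suc) S.V′ ((2 ^ (2 + e)) ^ suc k) S.|V′ᵢ|≤|Vᵢ| |U|>0 S.V′-large i ⟩
      (2 ^ (2 + e)) ^ suc k * length (S.V′ i) ∎)
    module rest = BlowUp (blowUp (deleteZero H) (λ u v w → triangleFree (suc u) (suc v) (suc w)) G
      L k (5 + (e + e)) S.V′ (toList S.blocks ++ Y) S.V′!
      (begin
        r * k + length (toList S.blocks ++ Y)       ≡⟨ cong (r * k +_) (List.length-++ (toList S.blocks)) ⟩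
        r * k + (length (toList S.blocks) + length Y)
          ≡⟨ cong (λ l → r * k + (l + length Y)) (length-toList S.blocks) ⟩
        r * k + (k + length Y)                      ≡⟨ +-assoc (r * k) k (length Y) ⟨
        r * k + k + length Y                        ≡⟨ cong (_+ length Y) (+-comm (r * k) k) ⟩
        suc r * k + length Y                        ≤⟨ |Y|≤L ⟩
        L                                           ∎)
      large′ S.V′-dense)
    rest≢blocks : ∀ i s t → rest.φ i s ≢ lookup S.blocks t
    rest≢blocks i s t eq = rest.φ∉Y i s (∈-++⁺ˡ (subst (_∈ toList S.blocks) (sym eq)
      (∈-toList⁺ (∈-lookup t S.blocks))))

  -- The coefficient c in threshold ≤ c e k, valid for L = h k and e, k ≥ 1.
  cost : (h r : ℕ) → ℕ
  cost h zero    = 0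
  cost h (suc r) = (3 + h) + (6 + 7 * cost h r)

  -- Additive constants are absorbed because both parameters are at least 1; for instance
  -- `5 + 2e ≤ 7e`. The factor 7 per round makes `cost` exponential in `h` but keeps it independent
  -- of `G` and of the density.
  threshold≤cost : ∀ h r e k → threshold (h * suc k) (suc k) r (suc e) ≤ cost h r * suc e * suc k
  threshold≤cost h zero    e k = z≤n
  threshold≤cost h (suc r) e k = begin
    (2 + suc e + h * suc k) + ((2 + suc e) * suc (suc k) + threshold (h * suc k) (suc k) r (5 + (suc e + suc e)))
      ≤⟨ +-mono-≤ first (+-mono-≤ second third) ⟩
    (3 + h) * suc e * suc k + (6 * suc e * suc k + 7 * cost h r * suc e * suc k)
      ≡⟨ collect (3 + h) (7 * cost h r) (suc e) (suc k) ⟩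
    cost h (suc r) * suc e * suc k ∎
    where
    open ≤-Reasoning
    collect : ∀ a b c d → a * c * d + (6 * c * d + b * c * d) ≡ (a + (6 + b)) * c * d
    collect = solve-∀
    first : 2 + suc e + h * suc k ≤ (3 + h) * suc e * suc k
    first = ≤-trans (m≤m+n _ _) (≤-reflexive (difference e k h))
      where
      difference : ∀ e k h → (2 + (1 + e) + h * (1 + k)) + (2 * e + 3 * k + 3 * e * k + h * e * (1 + k)) ≡ (3 + h) * (1 + e) * (1 + k)
      difference = solve-∀
    second : (2 + suc e) * suc (suc k) ≤ 6 * suc e * suc k
    second = ≤-trans (m≤m+n _ _) (≤-reflexive (difference e k))
      where
      difference : ∀ e k → (2 + (1 + e)) * (1 + (1 + k)) + (4 * e + 3 * k + 5 * e * k) ≡ 6 * (1 + e) * (1 + k)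
      difference = solve-∀
    third : threshold (h * suc k) (suc k) r (5 + (suc e + suc e)) ≤ 7 * cost h r * suc e * suc k
    third = begin
      threshold (h * suc k) (suc k) r (5 + (suc e + suc e))
        ≤⟨ threshold≤cost h r (4 + (suc e + suc e)) k ⟩
      cost h r * (5 + (suc e + suc e)) * suc k
        ≤⟨ *-monoˡ-≤ (suc k) (*-monoʳ-≤ (cost h r) (≤-trans (m≤m+n _ (5 * e)) (≤-reflexive (seven e)))) ⟩
      cost h r * (7 * suc e) * suc k
        ≡⟨ rearrange (cost h r) (suc e) (suc k) ⟩
      7 * cost h r * suc e * suc k ∎
      where
      seven : ∀ e → 5 + ((1 + e) + (1 + e)) + 5 * e ≡ 7 * (1 + e)
      seven = solve-∀
      rearrange : ∀ a b c → a * (7 * b) * c ≡ 7 * a * b * c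
      rearrange = solve-∀

  -- Copies as subgraphs and as tuples

  comprehension : ∀ {n} {P : Fin n → Set} → (∀ v → Dec (P v)) → Subset n
  comprehension P? = tabulate (λ v → does (P? v))

  ∈-comprehension⁺ : ∀ {n} {P : Fin n → Set} (P? : ∀ v → Dec (P v)) {v} → P v → v Subset.∈ comprehension P?
  ∈-comprehension⁺ P? {v} p = lookup⇒[]= v _ (trans (lookup∘tabulate _ v) (dec-true (P? v) p))

  ∈-comprehension⁻ : ∀ {n} {P : Fin n → Set} (P? : ∀ v → Dec (P v)) {v} → v Subset.∈ comprehension P? → P v
  ∈-comprehension⁻ P? {v} v∈ = decidable-stable (P? v) λ ¬p →
    contradiction (trans (sym (dec-false (P? v) ¬p)) (trans (sym (lookup∘tabulate _ v)) ([]=⇒lookup v∈))) λ ()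

  ∃∈-≡ : ∀ {n} {S : Subset n} {u v} {u∈S : u Subset.∈ S} {v∈S : v Subset.∈ S} → u ≡ v →
    _≡_ {A = ∃[ w ] w Subset.∈ S} (u , u∈S) (v , v∈S)
  ∃∈-≡ refl = cong (_ ,_) ([]=-irrelevant _ _)

  -- The subgraph keeps only the images of edges of `H [ k ]`: `G` may have further edges among
  -- these vertices, whereas an isomorphism has to reflect adjacency.
  contains-blowUp : ∀ {h n k} {H : Graph (Fin h)} {G : Graph (Fin n)} (φ : Fin h → Fin k → Fin n) →
    (∀ i j s t → φ i s ≡ φ j t → i ≡ j × s ≡ t) →
    (∀ i j s t → Graph._~_ H i j → Graph._~_ G (φ i s) (φ j t)) → G ContainsAsSubgraph (H [ k ])
  contains-blowUp {h} {n} {k} {H} {G} φ injective adjacent = S , S⊑G , record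
    { bijection = mk↔ₛ′
        (λ (i , s) → φ i s , ∈-comprehension⁺ image? (i , s , refl))
        (λ (v , v∈S) → let i , s , _ = ∈-comprehension⁻ image? v∈S in i , s)
        (λ (v , v∈S) → ∃∈-≡ (proj₂ (proj₂ (∈-comprehension⁻ image? v∈S))))
        (λ (i , s) → let j , t , φⱼₜ≡φᵢₛ = ∈-comprehension⁻ image? (∈-comprehension⁺ image? (i , s , refl))
                         j≡i , t≡s = injective j i t s φⱼₜ≡φᵢₛ
                     in cong₂ _,_ j≡i t≡s)
    ; adjacency = λ (i , s) (j , t) → mk⇔
        (λ i~j → edge⁺ (i , s , j , t , i~j , refl , refl))
        (λ e → let i′ , s′ , j′ , t′ , i′~j′ , eqᵢ , eqⱼ = edge⁻ e
               in subst₂ H._~_ (proj₁ (injective i′ i s′ s eqᵢ)) (proj₁ (injective j′ j t′ t eqⱼ)) i′~j′)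
    }
    where
    module G = Graph G
    module H = Graph H
    Image : Fin n → Set
    Image v = ∃[ i ] ∃[ s ] φ i s ≡ v
    image? : ∀ v → Dec (Image v)
    image? v = Fin.any? λ i → Fin.any? λ s → φ i s Fin.≟ v
    ImageEdge : Fin n → Fin n → Set
    ImageEdge u v = ∃[ i ] ∃[ s ] ∃[ j ] ∃[ t ] i H.~ j × φ i s ≡ u × φ j t ≡ v
    imageEdge? : ∀ u v → Dec (ImageEdge u v)
    imageEdge? u v = Fin.any? λ i → Fin.any? λ s → Fin.any? λ j → Fin.any? λ t →
      (i H.~? j) ×-dec (φ i s Fin.≟ u) ×-dec (φ j t Fin.≟ v)
    S : Subgraph n
    S = record { vertices = comprehension image? ; adjacents = tabulate (λ u → comprehension (imageEdge? u)) }
    edge⁺ : ∀ {u v} → ImageEdge u v → Edge S u v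
    edge⁺ {u} {v} e = subst (v Subset.∈_) (sym (lookup∘tabulate _ u)) (∈-comprehension⁺ (imageEdge? u) e)
    edge⁻ : ∀ {u v} → Edge S u v → ImageEdge u v
    edge⁻ {u} {v} e = ∈-comprehension⁻ (imageEdge? u) (subst (v Subset.∈_) (lookup∘tabulate _ u) e)
    S⊑G : S ⊑ G
    S⊑G = record
      { edge-sym      = λ e → let i , s , j , t , i~j , eqᵢ , eqⱼ = edge⁻ e
                              in edge⁺ (j , t , i , s , H.~-sym i~j , eqⱼ , eqᵢ)
      ; edge⇒vertex   = λ e → let i , s , _ , _ , _ , eqᵢ , _ = edge⁻ e in ∈-comprehension⁺ image? (i , s , eqᵢ)
      ; edge⇒adjacent = λ e → let i , s , j , t , i~j , eqᵢ , eqⱼ = edge⁻ e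
                              in subst₂ G._~_ eqᵢ eqⱼ (adjacent i j s t i~j)
      }

  module Copy {h n} {H : Graph (Fin h)} {G : Graph (Fin n)} {S : Subgraph n} (copy : IsCopy H G S) where

    private
      module G = Graph G
      module H = Graph H
      S⊑G = proj₁ copy
      open _⊑_ S⊑G
      open _≅_ (proj₂ copy)
      open Inverse bijection

    placement : Fin h → Fin n
    placement i = proj₁ (to i)

    placement-injective : ∀ {i j} → placement i ≡ placement j → i ≡ j
    placement-injective {i} {j} eq = trans (sym (strictlyInverseʳ i)) (trans (cong from (∃∈-≡ eq)) (strictlyInverseʳ j))

    placement-adjacent : ∀ {i j} → i H.~ j → placement i G.~ placement j
    placement-adjacent {i} {j} i~j = edge⇒adjacent (Equivalence.to (adjacency i j) i~j)

    vertex⁻ : ∀ {v} → v Subset.∈ vertices S → ∃[ i ] placement i ≡ v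
    vertex⁻ v∈S = from (_ , v∈S) , cong proj₁ (strictlyInverseˡ (_ , v∈S))

    vertex⁺ : ∀ i → placement i Subset.∈ vertices S
    vertex⁺ i = proj₂ (to i)

    edge⁻ : ∀ {u v} → Edge S u v → ∃[ i ] ∃[ j ] i H.~ j × placement i ≡ u × placement j ≡ v
    edge⁻ {u} {v} e =
      let i , eqᵢ = vertex⁻ (edge⇒vertex e)
          j , eqⱼ = vertex⁻ (edge⇒vertex (edge-sym e))
      in i , j , Equivalence.from (adjacency i j) (subst₂ (Edge S) (sym eqᵢ) (sym eqⱼ) e) , eqᵢ , eqⱼ

    edge⁺ : ∀ {i j} → i H.~ j → Edge S (placement i) (placement j)
    edge⁺ {i} {j} = Equivalence.to (adjacency i j)

    tuple : Vec (Fin n) h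
    tuple = tabulate placement

    tuple-isHom : IsHom H G tuple
    tuple-isHom i j i~j = subst₂ G._~_ (sym (lookup∘tabulate placement i)) (sym (lookup∘tabulate placement j))
      (placement-adjacent i~j)

  module _ {h n} {H : Graph (Fin h)} {G : Graph (Fin n)} where

    open Copy {H = H} {G} using (placement; tuple; tuple-isHom)

    -- The vertices and edges of a copy are exactly the images of those of `H`. Hence distinct
    -- copies give distinct tuples; one tuple per copy is recorded, so no count of automorphisms
    -- enters.
    placement-determines : ∀ {S S′} (c : IsCopy H G S) (c′ : IsCopy H G S′) → (∀ i → placement c i ≡ placement c′ i) → S ≡ S′
    placement-determines {S} {S′} c c′ eq = Subgraph-≡
      (⊆-antisym (vertices-⊆ c c′ eq) (vertices-⊆ c′ c (sym ∘ eq)))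
      (trans (sym (tabulate∘lookup _)) (trans
        (tabulate-cong (λ u → ⊆-antisym (edges-⊆ c c′ eq u) (edges-⊆ c′ c (sym ∘ eq) u))) (tabulate∘lookup _)))
      where
      Subgraph-≡ : ∀ {S S′ : Subgraph n} → vertices S ≡ vertices S′ → Subgraph.adjacents S ≡ Subgraph.adjacents S′ → S ≡ S′
      Subgraph-≡ refl refl = refl
      vertices-⊆ : ∀ {S S′} (c : IsCopy H G S) (c′ : IsCopy H G S′) → (∀ i → placement c i ≡ placement c′ i) →
        vertices S Subset.⊆ vertices S′
      vertices-⊆ {S′ = S′} c c′ eq v∈S = let i , eqᵢ = Copy.vertex⁻ c v∈S in
        subst (Subset._∈ vertices S′) (trans (sym (eq i)) eqᵢ) (Copy.vertex⁺ c′ i)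
      edges-⊆ : ∀ {S S′} (c : IsCopy H G S) (c′ : IsCopy H G S′) → (∀ i → placement c i ≡ placement c′ i) → ∀ u →
        lookup (Subgraph.adjacents S) u Subset.⊆ lookup (Subgraph.adjacents S′) u
      edges-⊆ {S′ = S′} c c′ eq u e = let i , j , i~j , eqᵢ , eqⱼ = Copy.edge⁻ c e in
        subst₂ (Edge S′) (trans (sym (eq i)) eqᵢ) (trans (sym (eq j)) eqⱼ) (Copy.edge⁺ c′ i~j)

    tuple-determines : ∀ {S S′} (c : IsCopy H G S) (c′ : IsCopy H G S′) → tuple c ≡ tuple c′ → S ≡ S′
    tuple-determines c c′ eq = placement-determines c c′ λ i →
      trans (sym (lookup∘tabulate _ i)) (trans (cong (λ φ → lookup φ i) eq) (lookup∘tabulate _ i))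

    tuples : ∀ {copies} → All (IsCopy H G) copies → List (Vec (Fin n) h)
    tuples = All.reduce tuple

    length-tuples : ∀ {copies} (cs : All (IsCopy H G) copies) → length (tuples cs) ≡ length copies
    length-tuples []       = refl
    length-tuples (c ∷ cs) = cong suc (length-tuples cs)

    tuples-isHom : ∀ {copies} (cs : All (IsCopy H G) copies) {φ} → φ ∈ tuples cs → IsHom H G φ
    tuples-isHom (c ∷ cs) (here refl) = tuple-isHom c
    tuples-isHom (c ∷ cs) (there φ∈)  = tuples-isHom cs φ∈

    tuples-Unique : ∀ {copies} (cs : All (IsCopy H G) copies) → Unique copies → Unique (tuples cs)
    tuples-Unique []       []          = []
    tuples-Unique (c ∷ cs) (S≢ ∷ cs!) = distinct cs S≢ ∷ tuples-Unique cs cs!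
      where
      distinct : ∀ {copies} (cs : All (IsCopy H G) copies) → All (_ ≢_) copies → All (tuple c ≢_) (tuples cs)
      distinct []        []          = []
      distinct (c′ ∷ cs) (S≢S′ ∷ S≢) = (S≢S′ ∘ tuple-determines c c′) ∷ distinct cs S≢

    ∈-box : ∀ {r} {V : Fin r → List A} (u : Vec A r) → (∀ i → lookup u i ∈ V i) → u ∈ box V
    ∈-box []      u∈V = here refl
    ∈-box (x ∷ u) u∈V = ∈-cartesianProductWith⁺ _∷_ (u∈V zero) (∈-box u (u∈V ∘ suc))

    #copies≤#hom : ∀ {copies} → Unique copies → All (IsCopy H G) copies → length copies ≤ #hom H G (λ _ → allFin n)
    #copies≤#hom {copies} copies! cs = begin
      length copies                           ≡⟨ length-tuples cs ⟨
      length (tuples cs)                      ≤⟨ length-Unique-⊆ (≡-dec Fin._≟_) (tuples-Unique cs copies!)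
        (λ {φ} φ∈ → ∈-filter⁺ (isHom? H G) (∈-box φ (λ i → ∈-allFin _)) (tuples-isHom cs φ∈)) ⟩
      length (filter (isHom? H G) all)        ≡⟨ ∑-1 (filter (isHom? H G) all) ⟨
      ∑ (filter (isHom? H G) all) (λ _ → 1)   ≡⟨ ∑-filter (isHom? H G) all _ ⟩
      ∑ all (λ φ → 𝟙 (isHom? H G φ) * 1)      ≡⟨ ∑-cong all (λ φ → *-identityʳ _) ⟩
      #hom H G (λ _ → allFin n)               ∎
      where
      open ≤-Reasoning
      all : List (Vec (Fin n) h)
      all = box (λ _ → allFin n)

  length-box-allFin : ∀ h n → length (box {r = h} (λ _ → allFin n)) ≡ n ^ h
  length-box-allFin zero    n = refl
  length-box-allFin (suc h) n = trans (length-box {r = h} (λ _ → allFin n))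
    (cong₂ _*_ (List.length-tabulate {n = n} (λ i → i)) (length-box-allFin h n))

  contains-large-blowUp : ∀ {h n} {H : Graph (Fin h)} → TriangleFree H → (G : Graph (Fin n)) → ∀ e k l {copies} →
    Unique copies → All (IsCopy H G) copies → n ^ h ≤ 2 ^ suc e * length copies →
    2 ^ l ≤ n → cost h h * suc e * suc k ≤ l → G ContainsAsSubgraph (H [ suc k ])
  contains-large-blowUp {h} {n} {H} triangleFree G e k l copies! cs dense 2^l≤n cost≤l =
    contains-blowUp φ injective adjacent
    where
    open BlowUp (blowUp H triangleFree G (h * suc k) (suc k) (suc e) (λ _ → allFin n) []
      (λ _ → Unique.allFin⁺ n)
      (≤-reflexive (+-identityʳ (h * suc k)))
      (λ _ → ≤-trans (^-monoʳ-≤ 2 (≤-trans (threshold≤cost h h e k) cost≤l))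
        (≤-trans 2^l≤n (≤-reflexive (sym (List.length-tabulate {n = n} (λ i → i))))))
      (≤-trans (≤-reflexive (length-box-allFin h n)) (≤-trans dense (*-monoʳ-≤ (2 ^ suc e) (#copies≤#hom copies! cs)))))

-- Comparison with real logarithms

open Combinatorics using (cost; contains-blowUp; contains-large-blowUp; module Copy)
open import Defs
open import Data.Fin using (Fin; zero; suc)
open import Data.List using (length)
open import Data.List.Relation.Unary.All using (All; []; _∷_)
open import Data.List.Relation.Unary.Unique.Propositional using (Unique)
open import Data.Integer using (+_)
import Data.Integer.Properties as ℤ
open import Data.Nat as ℕ using (ℕ; zero; suc; NonZero; _^_)
import Data.Nat.DivMod as ℕ
import Data.Nat.Properties as ℕ
open import Data.Nat.Tactic.RingSolver using (solve-∀)
open import Data.Product using (Σ-syntax; ∃-syntax; _×_; _,_)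
open import Data.Rational as ℚ using (ℚ; 0ℚ; 1ℚ; ½)
import Data.Rational.Properties as ℚ
open import Data.Rational.Solver using (module +-*-Solver)
open import Data.Sum using (_⊎_; inj₁; inj₂)
open import Relation.Binary.PropositionalEquality using (_≡_; refl; sym; trans; cong)
open import Relation.Nullary using (yes; no; contradiction)
open import Relation.Nullary.Decidable using (from-yes)
open import Algebra.Definitions.RawSemiring ℚ.+-*-rawSemiring using () renaming (_^_ to _^ℚ_)

ℕ⇒ℚ-nonNeg : ∀ n → 0ℚ ℚ.≤ ℕ⇒ℚ n
ℕ⇒ℚ-nonNeg n = ℕ⇒ℚ-mono-≤ (ℕ.z≤n {n})

ℕ⇒ℚ-pos : ∀ n .{{_ : NonZero n}} → ℚ.Positive (ℕ⇒ℚ n)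
ℕ⇒ℚ-pos n = ℚ.normalize-pos n 1

-- Any sN > c would leave room below sN = s′ (sN/s′), where s < s′ ∈ Lower γ, for c itself.
scaled-lower-bound : ∀ γ N c .{{_ : NonZero N}} → γ * fromℕ N ≤ fromℕ c →
  ∀ {s} → Lower γ s → 0ℚ ℚ.< s → s ℚ.* ℕ⇒ℚ N ℚ.≤ ℕ⇒ℚ c
scaled-lower-bound γ N c γN≤c {s} s∈γ 0<s with open′ γ s∈γ
... | s′ , s<s′ , s′∈γ = ℚ.≮⇒≥ λ c<sN → ℚ.<-irrefl refl (γN≤c (inj₂
    (s ℚ.* ℕ⇒ℚ N , (s′ , t , s′∈γ , t<N , ℚ.<⇒≤ 0<s′ , 0≤t , sym s′t≡sN) , c<sN)))
  where
  0<s′ = ℚ.<-trans 0<s s<s′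
  instance
    s-pos : ℚ.Positive s
    s-pos = ℚ.positive 0<s
    s′-pos : ℚ.Positive s′
    s′-pos = ℚ.positive 0<s′
    s′≢0 : ℚ.NonZero s′
    s′≢0 = ℚ.pos⇒nonZero s′
    N-pos : ℚ.Positive (ℕ⇒ℚ N)
    N-pos = ℕ⇒ℚ-pos N
  t : ℚ
  t = ℚ.1/ s′ ℚ.* (s ℚ.* ℕ⇒ℚ N)
  s′t≡sN : s′ ℚ.* t ≡ s ℚ.* ℕ⇒ℚ N
  s′t≡sN = trans (sym (ℚ.*-assoc s′ (ℚ.1/ s′) _)) (trans (cong (ℚ._* (s ℚ.* ℕ⇒ℚ N)) (ℚ.*-inverseʳ s′)) (ℚ.*-identityˡ _))
  t<N : t ℚ.< ℕ⇒ℚ N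
  t<N = ℚ.*-cancelˡ-<-nonNeg s′ {{ℚ.pos⇒nonNeg s′}} (ℚ.≤-<-trans (ℚ.≤-reflexive s′t≡sN) (ℚ.*-monoˡ-<-pos (ℕ⇒ℚ N) s<s′))
  0≤t : 0ℚ ℚ.≤ t
  0≤t = ℚ.≮⇒≥ λ t<0 → ℚ.<-asym
    (ℚ.<-≤-trans (ℚ.*-monoʳ-<-pos s′ t<0) (ℚ.≤-reflexive (ℚ.*-zeroʳ s′)))
    (ℚ.<-≤-trans (ℚ.positive⁻¹ _ {{ℚ.pos*pos⇒pos s (ℕ⇒ℚ N)}}) (ℚ.≤-reflexive (sym s′t≡sN)))

positive-count : ∀ γ → 0ℝ < γ → ∀ N c .{{_ : NonZero N}} → γ * fromℕ N ≤ fromℕ c → 0 ℕ.< c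
positive-count γ 0<γ N zero    γN≤0 = let s , 0<s , s∈γ = positive-member {γ} 0<γ in
  contradiction refl (ℚ.<⇒≢ (ℚ.<-≤-trans
    (ℚ.positive⁻¹ (s ℚ.* ℕ⇒ℚ N) {{ℚ.pos*pos⇒pos s {{ℚ.positive 0<s}} (ℕ⇒ℚ N) {{ℕ⇒ℚ-pos N}}}})
    (scaled-lower-bound γ N 0 γN≤0 s∈γ 0<s)))
positive-count γ 0<γ N (suc c) γN≤c = ℕ.s≤s ℕ.z≤n

-- With `F = suc f`, the exponent is `2 F` above but `F` below, so that one positive `F` serves both
-- as density exponent and as lower bound for `log (1/γ)`. If the search stops at `f ≡ 0`, the
-- hypothesis `γ ≤ ½` replaces the second inequality.
dyadic-ratio : ∀ N c → 0 ℕ.< c → ∃[ f ] N ℕ.≤ 2 ^ (suc f ℕ.+ suc f) ℕ.* c × (f ≡ 0 ⊎ 2 ^ suc f ℕ.* c ℕ.≤ N)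
dyadic-ratio N c 0<c = search N (ℕ.≤-trans (n≤2^n N) (ℕ.≤-trans
  (ℕ.^-monoʳ-≤ 2 (ℕ.≤-trans (ℕ.n≤1+n N) (ℕ.m≤m+n (suc N) (suc N))))
  (ℕ.≤-trans (ℕ.≤-reflexive (sym (ℕ.*-identityʳ _))) (ℕ.*-monoʳ-≤ (2 ^ (suc N ℕ.+ suc N)) 0<c))))
  where
  search : ∀ m → N ℕ.≤ 2 ^ (suc m ℕ.+ suc m) ℕ.* c → ∃[ f ] N ℕ.≤ 2 ^ (suc f ℕ.+ suc f) ℕ.* c × (f ≡ 0 ⊎ 2 ^ suc f ℕ.* c ℕ.≤ N)
  search zero    N≤ = 0 , N≤ , inj₁ refl
  search (suc m) N≤ with N ℕ.≤? 2 ^ (suc m ℕ.+ suc m) ℕ.* c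
  ... | yes N≤′ = search m N≤′
  ... | no  N≰′ = suc m , N≤ , inj₂ (ℕ.≤-trans
    (ℕ.*-monoˡ-≤ c (ℕ.^-monoʳ-≤ 2 (ℕ.s≤s (ℕ.m≤n+m (suc m) m)))) (ℕ.<⇒≤ (ℕ.≰⇒> N≰′)))

floor-log : ∀ n .{{_ : NonZero n}} → ∃[ l ] 2 ^ l ℕ.≤ n × n ℕ.≤ 2 ^ suc l
floor-log n = search n (ℕ.≤-trans (n≤2^n n) (ℕ.^-monoʳ-≤ 2 (ℕ.n≤1+n n)))
  where
  search : ∀ m → n ℕ.≤ 2 ^ suc m → ∃[ l ] 2 ^ l ℕ.≤ n × n ℕ.≤ 2 ^ suc l
  search zero    n≤ = 0 , ℕ.>-nonZero⁻¹ n , n≤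
  search (suc m) n≤ with n ℕ.≤? 2 ^ suc m
  ... | yes n≤′ = search m n≤′
  ... | no  n≰′ = suc m , ℕ.<⇒≤ (ℕ.≰⇒> n≰′) , n≤

Log-≤ : ∀ n l → n ℕ.≤ 2 ^ l → ∀ {p} → Log (fromℕ n) p → p ℚ.≤ ℕ⇒ℚ l
Log-≤ n l n≤2^l (m , d , r , r<n , 0≤r , 2^m≤r^d , refl) =
  /-mono-≤ m d l 0 (ℕ.≤-trans (ℕ.≤-reflexive (ℕ.*-identityʳ m)) (ℕ.≮⇒≥ λ ld<m →
    ℕ.<⇒≱ (ℕ.^-monoʳ-< 2 (ℕ.s≤s (ℕ.s≤s ℕ.z≤n)) ld<m) 2^m≤2^ld))
  where
  2^m≤2^ld : 2 ^ m ℕ.≤ 2 ^ (l ℕ.* suc d)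
  2^m≤2^ld = ℕ.≤-trans
    (ℕ⇒ℚ-cancel-≤ (ℚ.≤-trans 2^m≤r^d (ℚ.≤-trans
      (^-monoˡ 0≤r (ℚ.≤-trans (ℚ.<⇒≤ r<n) (ℕ⇒ℚ-mono-≤ n≤2^l)) (suc d))
      (ℚ.≤-reflexive (sym (ℕ⇒ℚ-^ (2 ^ l) (suc d)))))))
    (ℕ.≤-reflexive (ℕ.^-*-assoc 2 l (suc d)))

log₂-≤ : ∀ n l .{{_ : NonZero n}} → n ℕ.≤ 2 ^ l → ∀ {q} → Lower (log₂ (fromℕ n) (1≤fromℕ n)) q → q ℚ.≤ ℕ⇒ℚ l
log₂-≤ n l n≤2^l (inj₁ q<0)             = ℚ.≤-trans (ℚ.<⇒≤ q<0) (ℕ⇒ℚ-nonNeg l)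
log₂-≤ n l n≤2^l (inj₂ (p , p∈ , q<p)) = ℚ.≤-trans (ℚ.<⇒≤ q<p) (Log-≤ n l n≤2^l p∈)

-- The factor in the lower bound `F / 4` for the logarithm. For `f = 0` the exponent found in
-- `log₂-recip->` equals `F / 2`, and membership in a cut needs strict inequality.
¼ : ℚ
¼ = + 1 ℚ./ 4

module _ (γ : ℝ≥0) (0<γ : 0ℝ < γ) (γ≤½ : γ ≤ ½ℝ) where

  private
    L : ℝ≥0
    L = log₂ (recip γ 0<γ) (1≤recip γ 0<γ γ≤½)

  γ≤2^-F : ∀ N c f .{{_ : NonZero N}} → 0 ℕ.< c → γ * fromℕ N ≤ fromℕ c → f ≡ 0 ⊎ 2 ^ suc f ℕ.* c ℕ.≤ N →
    ∀ {s} → Lower γ s → 0ℚ ℚ.< s → s ℚ.* ℕ⇒ℚ (2 ^ suc f) ℚ.≤ 1ℚ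
  γ≤2^-F N c _ _   _    (inj₁ refl) s∈γ 0<s = γ*2≤1 γ 0<γ γ≤½ s∈γ
  γ≤2^-F N c f 0<c γN≤c (inj₂ 2^Fc≤N) {s} s∈γ 0<s = ℚ.*-cancelʳ-≤-pos (ℕ⇒ℚ c) {{ℕ⇒ℚ-pos c {{ℕ.>-nonZero 0<c}}}} (begin
    s ℚ.* ℕ⇒ℚ (2 ^ suc f) ℚ.* ℕ⇒ℚ c    ≡⟨ ℚ.*-assoc s _ _ ⟩
    s ℚ.* (ℕ⇒ℚ (2 ^ suc f) ℚ.* ℕ⇒ℚ c)  ≡⟨ cong (s ℚ.*_) (ℕ⇒ℚ-* (2 ^ suc f) c) ⟨
    s ℚ.* ℕ⇒ℚ (2 ^ suc f ℕ.* c)        ≤⟨ ℚ.*-monoˡ-≤-nonNeg s {{ℚ.nonNegative (ℚ.<⇒≤ 0<s)}} (ℕ⇒ℚ-mono-≤ 2^Fc≤N) ⟩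
    s ℚ.* ℕ⇒ℚ N                        ≤⟨ scaled-lower-bound γ N c γN≤c s∈γ 0<s ⟩
    ℕ⇒ℚ c                              ≡⟨ ℚ.*-identityˡ (ℕ⇒ℚ c) ⟨
    1ℚ ℚ.* ℕ⇒ℚ c                       ∎)
    where open ℚ.≤-Reasoning

  -- The witness is r = (3/2) 2ᶠ < 2ᶠ⁺¹ ≤ 1/γ, whose square is at least 2²ᶠ⁺¹.
  log₂-recip-> : ∀ f → (∀ {s} → Lower γ s → 0ℚ ℚ.< s → s ℚ.* ℕ⇒ℚ (2 ^ suc f) ℚ.≤ 1ℚ) →
    Lower L (ℕ⇒ℚ (suc f) ℚ.* ¼)
  log₂-recip-> f γ≤ = inj₂ (+ (suc (f ℕ.+ f)) ℚ./ 2 , (suc (f ℕ.+ f) , 1 , r , inj₂ (ℕ⇒ℚ (2 ^ suc f) , γ≤ , r<2^F) , 0≤r , 2^m≤r² , refl) , F/4<p)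
    where
    open ℚ.≤-Reasoning
    b = ℕ⇒ℚ (2 ^ f)
    r = (+ 3 ℚ./ 2) ℚ.* b
    instance
      b-pos : ℚ.Positive b
      b-pos = ℕ⇒ℚ-pos (2 ^ f) {{ℕ.m^n≢0 2 f}}
    r<2^F : r ℚ.< ℕ⇒ℚ (2 ^ suc f)
    r<2^F = ℚ.<-≤-trans (ℚ.*-monoˡ-<-pos b (from-yes (+ 3 ℚ./ 2 ℚ.<? ℕ⇒ℚ 2))) (ℚ.≤-reflexive (sym (ℕ⇒ℚ-* 2 (2 ^ f))))
    0≤r : 0ℚ ℚ.≤ r
    0≤r = ℚ.<⇒≤ (ℚ.positive⁻¹ r {{ℚ.pos*pos⇒pos (+ 3 ℚ./ 2) b}})
    square : r ^ℚ 2 ≡ (+ 3 ℚ./ 2) ^ℚ 2 ℚ.* (b ℚ.* b)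
    square = solve 2 (λ a b → a :* b :* (a :* b :* con 1ℚ) := a :* (a :* con 1ℚ) :* (b :* b)) refl (+ 3 ℚ./ 2) b
      where open +-*-Solver
    2^m≤r² : ℕ⇒ℚ (2 ^ suc (f ℕ.+ f)) ℚ.≤ r ^ℚ 2
    2^m≤r² = begin
      ℕ⇒ℚ (2 ^ suc (f ℕ.+ f))            ≡⟨ cong (λ x → ℕ⇒ℚ (2 ℕ.* x)) (ℕ.^-distribˡ-+-* 2 f f) ⟩
      ℕ⇒ℚ (2 ℕ.* (2 ^ f ℕ.* 2 ^ f))      ≡⟨ ℕ⇒ℚ-* 2 (2 ^ f ℕ.* 2 ^ f) ⟩
      ℕ⇒ℚ 2 ℚ.* ℕ⇒ℚ (2 ^ f ℕ.* 2 ^ f)    ≡⟨ cong (ℕ⇒ℚ 2 ℚ.*_) (ℕ⇒ℚ-* (2 ^ f) (2 ^ f)) ⟩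
      ℕ⇒ℚ 2 ℚ.* (b ℚ.* b)                ≤⟨ ℚ.*-monoʳ-≤-nonNeg (b ℚ.* b) {{ℚ.pos⇒nonNeg (b ℚ.* b) {{ℚ.pos*pos⇒pos b b}}}}
                                              (from-yes (ℕ⇒ℚ 2 ℚ.≤? (+ 3 ℚ./ 2) ^ℚ 2)) ⟩
      (+ 3 ℚ./ 2) ^ℚ 2 ℚ.* (b ℚ.* b)     ≡⟨ square ⟨
      r ^ℚ 2                             ∎
    F/4<p : ℕ⇒ℚ (suc f) ℚ.* ¼ ℚ.< + suc (f ℕ.+ f) ℚ./ 2
    F/4<p = ℚ.<-≤-trans (ℚ.*-monoʳ-<-pos (ℕ⇒ℚ (suc f)) {{ℕ⇒ℚ-pos (suc f)}} (from-yes (¼ ℚ.<? ½)))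
      (ℚ.≤-trans (ℚ.≤-reflexive half) (/-mono-≤ (suc f) 1 (suc (f ℕ.+ f)) 1 (ℕ.*-monoˡ-≤ 2 (ℕ.s≤s (ℕ.m≤m+n f f)))))
      where
      half : ℕ⇒ℚ (suc f) ℚ.* ½ ≡ + suc f ℚ./ 2
      half rewrite ℕ⇒ℚ≡mkℚ (suc f) = cong (ℚ._/ 2) (ℤ.*-identityʳ (+ suc f))

  -- The defining property of the reciprocal, tested at the one known positive member `F / 4` of the
  -- cut `L`, bounds each factor from `recip L`; the other factor is at most `l`.
  ratio-≤ : ∀ n l f .{{_ : NonZero n}} → n ℕ.≤ 2 ^ l → Lower L (ℕ⇒ℚ (suc f) ℚ.* ¼) →
    ∀ {q} → Lower (divide (log₂ (fromℕ n) (1≤fromℕ n)) L (0<log₂-recip γ 0<γ γ≤½)) q →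
    ℕ⇒ℚ (suc f) ℚ.* ¼ ℚ.* q ℚ.≤ ℕ⇒ℚ l
  ratio-≤ n l f n≤2^l F/4∈L {q} q∈ = bound q∈
    where
    open ℚ.≤-Reasoning
    g = ℕ⇒ℚ (suc f) ℚ.* ¼
    instance
      g-pos : ℚ.Positive g
      g-pos = ℚ.pos*pos⇒pos (ℕ⇒ℚ (suc f)) {{ℕ⇒ℚ-pos (suc f)}} ¼
      g-nonNeg : ℚ.NonNegative g
      g-nonNeg = ℚ.pos⇒nonNeg g
    recip-≤ : ∀ {d} → Lower (recip L (0<log₂-recip γ 0<γ γ≤½)) d → g ℚ.* d ℚ.≤ 1ℚ
    recip-≤ (inj₁ d<0) = ℚ.≤-trans (ℚ.*-monoˡ-≤-nonNeg g (ℚ.<⇒≤ d<0)) (ℚ.≤-trans (ℚ.≤-reflexive (ℚ.*-zeroʳ g)) (from-yes (0ℚ ℚ.≤? 1ℚ)))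
    recip-≤ (inj₂ (r , r∈ , d<r)) = ℚ.≤-trans (ℚ.*-monoˡ-≤-nonNeg g (ℚ.<⇒≤ d<r)) (r∈ F/4∈L (ℚ.positive⁻¹ g))
    bound : Lower (divide (log₂ (fromℕ n) (1≤fromℕ n)) L (0<log₂-recip γ 0<γ γ≤½)) q → g ℚ.* q ℚ.≤ ℕ⇒ℚ l
    bound (inj₁ q<0) = ℚ.≤-trans (ℚ.*-monoˡ-≤-nonNeg g (ℚ.<⇒≤ q<0)) (ℚ.≤-trans (ℚ.≤-reflexive (ℚ.*-zeroʳ g)) (ℕ⇒ℚ-nonNeg l))
    bound (inj₂ (_ , (c , d , c∈ , d∈ , 0≤c , 0≤d , refl) , q<cd)) = begin
      g ℚ.* q          ≤⟨ ℚ.*-monoˡ-≤-nonNeg g (ℚ.<⇒≤ q<cd) ⟩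
      g ℚ.* (c ℚ.* d)  ≡⟨ solve 3 (λ g c d → g :* (c :* d) := c :* (g :* d)) refl g c d ⟩
      c ℚ.* (g ℚ.* d)  ≤⟨ ℚ.*-monoˡ-≤-nonNeg c {{ℚ.nonNegative 0≤c}} (recip-≤ d∈) ⟩
      c ℚ.* 1ℚ         ≡⟨ ℚ.*-identityʳ c ⟩
      c                ≤⟨ log₂-≤ n l n≤2^l c∈ ⟩
      ℕ⇒ℚ l            ∎
      where open +-*-Solver

module Inverse (A : ℕ) .{{_ : NonZero A}} where

  private instance
    A-pos : ℚ.Positive (ℕ⇒ℚ A)
    A-pos = ℕ⇒ℚ-pos A
    A≢0 : ℚ.NonZero (ℕ⇒ℚ A)
    A≢0 = ℚ.pos⇒nonZero (ℕ⇒ℚ A)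

  A⁻¹ : ℚ
  A⁻¹ = ℚ.1/ ℕ⇒ℚ A

  A⁻¹-pos : ℚ.Positive A⁻¹
  A⁻¹-pos = ℚ.1/pos⇒pos (ℕ⇒ℚ A)

  A⁻¹-nonNeg : ℚ.NonNegative A⁻¹
  A⁻¹-nonNeg = ℚ.pos⇒nonNeg A⁻¹ {{A⁻¹-pos}}

  A*A⁻¹≡1 : ℕ⇒ℚ A ℚ.* A⁻¹ ≡ 1ℚ
  A*A⁻¹≡1 = ℚ.*-inverseʳ (ℕ⇒ℚ A)

-- With α = 1/A and x bounded by 4 l / F, the product α x is at most k as soon as 4 l ≤ A F k.
scaled-≤ : ∀ A .{{_ : NonZero A}} x F l k .{{_ : NonZero F}} →
  (∀ {q} → Lower x q → ℕ⇒ℚ F ℚ.* ¼ ℚ.* q ℚ.≤ ℕ⇒ℚ l) → 4 ℕ.* l ℕ.≤ A ℕ.* F ℕ.* k →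
  fromℚ (Inverse.A⁻¹ A) {{Inverse.A⁻¹-nonNeg A}} * x ≤ fromℕ k
scaled-≤ A x F l k x≤ 4l≤AFk (inj₁ q<0) = ℚ.<-≤-trans q<0 (ℕ⇒ℚ-nonNeg k)
scaled-≤ A x F l k x≤ 4l≤AFk (inj₂ (_ , (a , b , a<A⁻¹ , b∈x , 0≤a , 0≤b , refl) , q<ab)) = ℚ.<-≤-trans q<ab
  (ℚ.*-cancelˡ-≤-pos AF {{ℚ.pos*pos⇒pos (ℕ⇒ℚ A) {{ℕ⇒ℚ-pos A}} (ℕ⇒ℚ F) {{ℕ⇒ℚ-pos F}}}} (begin
    AF ℚ.* (a ℚ.* b)
      ≤⟨ ℚ.*-monoˡ-≤-nonNeg AF {{AF-nonNeg}} (ℚ.*-monoʳ-≤-nonNeg b {{ℚ.nonNegative 0≤b}} (ℚ.<⇒≤ a<A⁻¹)) ⟩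
    AF ℚ.* (A⁻¹ ℚ.* b)
      ≡⟨ solve 4 (λ A F c b → A :* F :* (c :* b) := con (ℕ⇒ℚ 4) :* (A :* c :* (F :* con ¼ :* b))) refl (ℕ⇒ℚ A) (ℕ⇒ℚ F) A⁻¹ b ⟩
    ℕ⇒ℚ 4 ℚ.* (ℕ⇒ℚ A ℚ.* A⁻¹ ℚ.* (ℕ⇒ℚ F ℚ.* ¼ ℚ.* b))
      ≡⟨ cong (λ c → ℕ⇒ℚ 4 ℚ.* (c ℚ.* (ℕ⇒ℚ F ℚ.* ¼ ℚ.* b))) A*A⁻¹≡1 ⟩
    ℕ⇒ℚ 4 ℚ.* (1ℚ ℚ.* (ℕ⇒ℚ F ℚ.* ¼ ℚ.* b))
      ≡⟨ cong (ℕ⇒ℚ 4 ℚ.*_) (ℚ.*-identityˡ (ℕ⇒ℚ F ℚ.* ¼ ℚ.* b)) ⟩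
    ℕ⇒ℚ 4 ℚ.* (ℕ⇒ℚ F ℚ.* ¼ ℚ.* b)
      ≤⟨ ℚ.*-monoˡ-≤-nonNeg (ℕ⇒ℚ 4) (x≤ b∈x) ⟩
    ℕ⇒ℚ 4 ℚ.* ℕ⇒ℚ l
      ≡⟨ ℕ⇒ℚ-* 4 l ⟨
    ℕ⇒ℚ (4 ℕ.* l)
      ≤⟨ ℕ⇒ℚ-mono-≤ 4l≤AFk ⟩
    ℕ⇒ℚ (A ℕ.* F ℕ.* k)
      ≡⟨ trans (ℕ⇒ℚ-* (A ℕ.* F) k) (cong (ℚ._* ℕ⇒ℚ k) (ℕ⇒ℚ-* A F)) ⟩
    AF ℚ.* ℕ⇒ℚ k ∎))
  where
  open Inverse A
  open ℚ.≤-Reasoning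
  open +-*-Solver
  AF : ℚ
  AF = ℕ⇒ℚ A ℚ.* ℕ⇒ℚ F
  AF-nonNeg : ℚ.NonNegative AF
  AF-nonNeg = ℚ.nonNegative (ℚ.≤-trans (ℕ⇒ℚ-nonNeg (A ℕ.* F)) (ℚ.≤-reflexive (ℕ⇒ℚ-* A F)))

-- Choice of the block size

quotient : ∀ m .{{_ : NonZero m}} l → l ℕ.< m ⊎ ∃[ k ] m ℕ.* suc k ℕ.≤ l × l ℕ.< m ℕ.* suc (suc k)
quotient m l with l ℕ./ m in eq
... | zero  = inj₁ (ℕ.m/n≡0⇒m<n eq)
... | suc k = inj₂ (k
    , ℕ.≤-trans (ℕ.≤-reflexive (trans (cong (m ℕ.*_) (sym eq)) (ℕ.*-comm m (l ℕ./ m)))) (ℕ.m/n*n≤m l m)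
    , (begin-strict
        l                        ≡⟨ ℕ.m≡m%n+[m/n]*n l m ⟩
        l ℕ.% m ℕ.+ l ℕ./ m ℕ.* m  <⟨ ℕ.+-monoˡ-< (l ℕ./ m ℕ.* m) (ℕ.m%n<n l m) ⟩
        suc (l ℕ./ m) ℕ.* m      ≡⟨ cong (λ q → suc q ℕ.* m) eq ⟩
        suc (suc k) ℕ.* m        ≡⟨ ℕ.*-comm (suc (suc k)) m ⟩
        m ℕ.* suc (suc k)        ∎))
  where open ℕ.≤-Reasoning

-- This covers the range where `log n` is so small against `log (1/γ)` that block size 1 meets the
-- bound.
copy⇒contains-blowUp₁ : ∀ {h n} {H : Graph (Fin h)} {G : Graph (Fin n)} {copies} →
  0 ℕ.< length copies → All (IsCopy H G) copies → G ContainsAsSubgraph (H [ 1 ])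
copy⇒contains-blowUp₁ _ (c ∷ _) = contains-blowUp (λ i _ → placement i)
  (λ { i j zero zero eq → placement-injective eq , refl }) (λ i j _ _ → placement-adjacent)
  where open Copy c

-- The block size is max(1, ⌊l / (C E)⌋), where E = 2 F is the exponent of the density 2⁻ᴱ.
find-blowUp : ∀ {h n} {H : Graph (Fin h)} → TriangleFree H → (G : Graph (Fin n)) → ∀ f l {copies} →
  Unique copies → All (IsCopy H G) copies → 0 ℕ.< length copies →
  n ^ h ℕ.≤ 2 ^ (suc f ℕ.+ suc f) ℕ.* length copies → 2 ^ l ℕ.≤ n →
  ∃[ k ] G ContainsAsSubgraph (H [ suc k ]) × 4 ℕ.* suc l ℕ.≤ 16 ℕ.* suc (cost h h) ℕ.* suc f ℕ.* suc k
find-blowUp {h} triangleFree G f l copies! cs 0<copies dense 2^l≤n with quotient (suc (cost h h) ℕ.* (suc f ℕ.+ suc f)) l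
... | inj₁ l<CE = 0 , copy⇒contains-blowUp₁ 0<copies cs , (begin
  4 ℕ.* suc l                                        ≤⟨ ℕ.*-monoʳ-≤ 4 l<CE ⟩
  4 ℕ.* (suc (cost h h) ℕ.* (suc f ℕ.+ suc f))       ≤⟨ ℕ.m≤m+n _ _ ⟩
  4 ℕ.* (suc (cost h h) ℕ.* (suc f ℕ.+ suc f)) ℕ.+ 8 ℕ.* suc (cost h h) ℕ.* suc f
                                                     ≡⟨ rearrange (suc (cost h h)) (suc f) ⟩
  16 ℕ.* suc (cost h h) ℕ.* suc f ℕ.* 1              ∎)
  where
  open ℕ.≤-Reasoning
  rearrange : ∀ c f → 4 ℕ.* (c ℕ.* (f ℕ.+ f)) ℕ.+ 8 ℕ.* c ℕ.* f ≡ 16 ℕ.* c ℕ.* f ℕ.* 1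
  rearrange = solve-∀
... | inj₂ (k , CEk≤l , l<CEk) = k
  , contains-large-blowUp triangleFree G (f ℕ.+ suc f) k l copies! cs dense 2^l≤n
      (ℕ.≤-trans (ℕ.*-monoˡ-≤ (suc k) (ℕ.*-monoˡ-≤ (suc f ℕ.+ suc f) (ℕ.n≤1+n (cost h h)))) CEk≤l)
  , (begin
  4 ℕ.* suc l                                                     ≤⟨ ℕ.*-monoʳ-≤ 4 l<CEk ⟩
  4 ℕ.* (suc (cost h h) ℕ.* (suc f ℕ.+ suc f) ℕ.* suc (suc k))    ≤⟨ ℕ.m≤m+n _ _ ⟩
  4 ℕ.* (suc (cost h h) ℕ.* (suc f ℕ.+ suc f) ℕ.* suc (suc k)) ℕ.+ 8 ℕ.* suc (cost h h) ℕ.* suc f ℕ.* k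
                                                                  ≡⟨ rearrange (suc (cost h h)) (suc f) k ⟩
  16 ℕ.* suc (cost h h) ℕ.* suc f ℕ.* suc k                       ∎)
  where
  open ℕ.≤-Reasoning
  rearrange : ∀ c f k → 4 ℕ.* (c ℕ.* (f ℕ.+ f) ℕ.* (1 ℕ.+ (1 ℕ.+ k))) ℕ.+ 8 ℕ.* c ℕ.* f ℕ.* k ≡ 16 ℕ.* c ℕ.* f ℕ.* (1 ℕ.+ k)
  rearrange = solve-∀

theorem1p2 : (h : ℕ) (H : Graph (Fin h)) → TriangleFree H →
    Σ[ α ∈ ℝ≥0 ] 0ℝ < α ×
    ((γ : ℝ≥0) (0<γ : 0ℝ < γ) (γ≤½ : γ ≤ ½ℝ)
    (n : ℕ) .{{_ : NonZero n}}
    (G : Graph (Fin n)) →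
    AtLeastCopies (γ * fromℕ (n ^ h)) H G →
    Σ[ k ∈ ℕ ] NonZero k ×
    G ContainsAsSubgraph (H [ k ]) ×
    α * divide (log₂ (fromℕ n) (1≤fromℕ n))
    (log₂ (recip γ 0<γ) (1≤recip γ 0<γ γ≤½))
    (0<log₂-recip γ 0<γ γ≤½)
    ≤ fromℕ k)
theorem1p2 h H triangleFree = fromℚ A⁻¹ {{A⁻¹-nonNeg}} , (0ℚ , ℚ.<-irrefl refl , ℚ.positive⁻¹ A⁻¹ {{A⁻¹-pos}}) , main
  where
  A : ℕ
  -- The 16 is a product of three factors: 4 cancels `¼`, 2 comes from the density exponent `2 F`,
  -- and 2 from rounding the block size `K` down, as `K + 1 ≤ 2 K`.
  A = 16 ℕ.* suc (cost h h)
  open Inverse A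
  main : (γ : ℝ≥0) (0<γ : 0ℝ < γ) (γ≤½ : γ ≤ ½ℝ) (n : ℕ) .{{_ : NonZero n}} (G : Graph (Fin n)) →
    AtLeastCopies (γ * fromℕ (n ^ h)) H G →
    Σ[ k ∈ ℕ ] NonZero k × G ContainsAsSubgraph (H [ k ]) ×
    fromℚ A⁻¹ {{A⁻¹-nonNeg}} * divide (log₂ (fromℕ n) (1≤fromℕ n)) (log₂ (recip γ 0<γ) (1≤recip γ 0<γ γ≤½))
      (0<log₂-recip γ 0<γ γ≤½) ≤ fromℕ k
  main γ 0<γ γ≤½ n G (copies , copies! , cs , γN≤c) =
    let c = length copies
        instance
          N≢0 : NonZero (n ^ h)
          N≢0 = ℕ.m^n≢0 n h
        0<c = positive-count γ 0<γ (n ^ h) c γN≤c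
        f , N≤2^2F*c , 2^F*c≤N = dyadic-ratio (n ^ h) c 0<c
        -- The lower power of 2 supplies room for the construction; the upper one bounds `log₂ n`,
        -- hence `suc l` in the final estimate.
        l , 2^l≤n , n≤2^1+l = floor-log n
        k , contains , 4l≤AFk = find-blowUp triangleFree G f l copies! cs 0<c N≤2^2F*c 2^l≤n
        F/4∈log = log₂-recip-> γ 0<γ γ≤½ f (γ≤2^-F γ 0<γ γ≤½ (n ^ h) c f 0<c γN≤c 2^F*c≤N)
    in suc k , _ , contains ,
       scaled-≤ A (divide (log₂ (fromℕ n) (1≤fromℕ n)) (log₂ (recip γ 0<γ) (1≤recip γ 0<γ γ≤½)) (0<log₂-recip γ 0<γ γ≤½)) (suc f) (suc l) (suc k) (ratio-≤ γ 0<γ γ≤½ n (suc l) f n≤2^1+l F/4∈log) 4l≤AFk
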